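{- For all integers $n\geq 3$ and $r\geq 1$ there exists an integer $s$ such that every even carousel of order $s$ on $n$ sets and every odd carousel of order $s$ on $n$ sets has rankwidth at least $r$.
   Context: All graphs are finite and simple. Let $X=\{u^1,\dots,u^k\}$ and $X'=\{v^1,\dots,v^k\}$ be two disjoint ordered sets of $k$ vertices of a graph $G$. The triple $(G,X,X')$ is called: - a regular matching if for all $j,j'\in\{1,\dots,k\}$: $u^jv^{j'}\in E(G)$ iff $j=j'$; - a regular antimatching if: $u^jv^{j'}\in E(G)$ iff $j\neq j'$; - a regular crossing if: $u^jv^{j'}\in E(G)$ iff $j+j'\geq k+1$; - an expanding matching if: $u^jv^{j'}\in E(G)$ iff $j'=2j$ or $j'=2j+1$; - an expanding antimatching if: $u^jv^{j'}\in E(G)$ iff $j'\neq 2j$ and $j'\neq 2j+1$; - an expanding crossing if: $u^jv^{j'}\in E(G)$ iff $2j+j'\geq 2k+2$; - (when $k\equiv 2 \pmod 4$) a skew expanding matching if, for all $j'\in\{1,\dots,k\}$: for $1\le j\le (k-2)/4$, $u^jv^{j'}\in E(G)$ iff $j'\in\{2j,2j+1\}$; for $(k-2)/4< j\le (3k+2)/4$, $u^jv^{j'}\notin E(G)$; for $(3k+2)/4<j\le k$, $u^jv^{j'}\in E(G)$ iff $j'\in\{2j-k-2,2j-k-1\}$; - (when $k\equiv 2\pmod 4$) a skew expanding antimatching if it is defined as the skew expanding matching except that for $(k-2)/4< j\le (3k+2)/4$, $u^jv^{j'}\in E(G)$ for all $j'$; - (when $k\equiv 2\pmod 4$) a skew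 expanding crossing if, for all $j'\in\{1,\dots,k\}$: for $1\le j\le (k-2)/4$, $u^jv^{j'}\in E(G)$ iff $2j+j'\geq k$; for $(k-2)/4<j\le k/2$, iff $j'\geq k/2+1$; for $k/2<j\le (3k+2)/4$, iff $j'\geq k/2-1$; for $(3k+2)/4<j\le k$, iff $2j+j'-2\geq 2k$. A triple is regular (resp. expanding, skew expanding) if it is one of the three regular (resp. expanding, skew expanding) kinds. Crossings (regular, expanding or skew expanding) are called cross triples; matchings and antimatchings are parallel triples. A carousel on $n\geq 3$ sets of cardinality $k$ is a graph $G$ with $V(G)=X_1\cup\dots\cup X_n$ (disjoint), each $X_i=\{x_i^1,\dots,x_i^k\}$ ordered, such that $(G,X_1,X_2)$ is a regular crossing, $(G,X_i,X_{i+1})$ is a regular triple for every $i\in\{2,\dots,n-1\}$, and $(G,X_n,X_1)$ is an expanding or skew expanding triple. Edges inside the $X_i$ and between $X_i,X_j$ with $j\notin\{i-1,i,i+1\}$ (indices mod $n$) are arbitrary. For an integer $s\geq1$, an even carousel of order $s$ on $n$ sets is a carousel with $k=2^s-1$, an even number of cross triples among $(G,X_i,X_{i+1})$, $i=1,\dots,n$ (indices mod $n$, so $(G,X_n,X_1)$ is included), and $(G,X_n,X_1)$ expanding. An odd carousel of order $s$ on $n$ sets is a carousel with $k=2(2^s-1)$, an odd number of cross triples among these $n$ triples, and $(G,X_n,X_1)$ skew expanding. Rankwidth: for disjoint $Y,Z\subseteq V(G)$, $\mathrm{rk}_G(Y,Z)$ is the rank over $\mathrm{GF}(2)$ of the 0-1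 matrix with rows indexed by $Y$, columns by $Z$, entry $1$ iff the two vertices are adjacent. A tree decomposition of $G$ is a cubic tree $T$ (at least two nodes, every non-leaf node of degree 3) whose leaf set is $V(G)$; each edge $e$ of $T$ splits the leaves into $(A_e,B_e)$ and has width $\mathrm{rk}_G(A_e,B_e)$; the width of $T$ is its maximum edge width; the rankwidth of $G$ is the minimum width of a tree decomposition (and $0$ if $|V(G)|\le 1$). -}

module Defs where

open import Data.Bool using (Bool; true; false; not; _∧_; _∨_; _xor_; if_then_else_)
open import Data.Nat using (ℕ; zero; suc; _+_; _*_; _∸_; _^_; _≤_; _/_; _%_; _≡ᵇ_; _≤ᵇ_)
open import Data.Fin using (Fin; toℕ) renaming (zero to fz; suc to fs)
open import Data.Product using (Σ; ∃; _×_; _,_)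
open import Data.Sum using (_⊎_)
open import Relation.Binary.PropositionalEquality using (_≡_; _≢_)
open import Relation.Nullary using (¬_)

countTrue : ∀ {m} → (Fin m → Bool) → ℕ
countTrue {zero} f = 0
countTrue {suc m} f = (if f fz then 1 else 0) + countTrue (λ i → f (fs i))

xorSum : ∀ {m} → (Fin m → Bool) → Bool
xorSum {zero} f = false
xorSum {suc m} f = f fz xor xorSum (λ i → f (fs i))

record Graph (V : Set) : Set where
  field
    adj    : V → V → Bool
    adj-sym : ∀ u v → adj u v ≡ adj v u
    adj-irr : ∀ v → adj v v ≡ false
open Graph public

-- GF(2) rank of the adjacency matrix between Y and Z (Y, Z disjoint)
-- rk_G(Y,Z) ≥ r  iff there are r rows (vertices of Y) that are linearly
-- independent over GF(2) as vectors indexed by Z: every nontrivial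
-- GF(2)-combination (= nonempty subset S) of them is a nonzero vector.

RankAtLeast : ∀ {V} → Graph V → (V → Set) → (V → Set) → ℕ → Set
RankAtLeast {V} G Y Z r =
  Σ (Fin r → V) λ f →
    (∀ i → Y (f i)) ×
    (∀ (S : Fin r → Bool) → (∃ λ i → S i ≡ true) →
       ∃ λ z → Z z × (xorSum (λ i → S i ∧ adj G (f i) z) ≡ true))

data Walk {A : Set} (R : A → A → Set) : A → A → Set where
  here : ∀ {x} → Walk R x x
  step : ∀ {x y z} → R x y → Walk R y z → Walk R x z

record TreeDecomp {V : Set} (G : Graph V) : Set where
  field
    m     : ℕ
    tadj  : Fin m → Fin m → Bool
    tsym  : ∀ x y → tadj x y ≡ tadj y x
    tirr  : ∀ x → tadj x x ≡ false
    two   : 2 ≤ m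
    -- T is a tree: connected, and every edge is a bridge (minimally connected)
    connected : ∀ x y → Walk (λ u w → tadj u w ≡ true) x y
    bridges   : ∀ x y → tadj x y ≡ true →
                ¬ Walk (λ u w → (tadj u w ≡ true) × ¬ (u ≡ x × w ≡ y) × ¬ (u ≡ y × w ≡ x)) x y
    cubic : ∀ x → countTrue (tadj x) ≡ 1 ⊎ countTrue (tadj x) ≡ 3
    leaf      : V → Fin m
    leaf-inj  : ∀ u v → leaf u ≡ leaf v → u ≡ v
    leaf-deg  : ∀ v → countTrue (tadj (leaf v)) ≡ 1
    leaf-surj : ∀ x → countTrue (tadj x) ≡ 1 → ∃ λ v → leaf v ≡ x
open TreeDecomp public

-- For the tree edge e = xy: A_e = leaves in the component of T - e containing x,
-- B_e = the remaining leaves.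
SideA : ∀ {V} {G : Graph V} → (T : TreeDecomp G) → Fin (m T) → Fin (m T) → V → Set
SideA T x y v =
  Walk (λ u w → (tadj T u w ≡ true) × ¬ (u ≡ x × w ≡ y) × ¬ (u ≡ y × w ≡ x)) x (leaf T v)

SideB : ∀ {V} {G : Graph V} → (T : TreeDecomp G) → Fin (m T) → Fin (m T) → V → Set
SideB T x y v = ¬ SideA T x y v

WidthAtLeast : ∀ {V} {G : Graph V} → TreeDecomp G → ℕ → Set
WidthAtLeast {G = G} T r =
  ∃ λ x → ∃ λ y → (tadj T x y ≡ true) × RankAtLeast G (SideA T x y) (SideB T x y) r

-- rankwidth(G) ≥ r : rankwidth is 0 if |V| ≤ 1, and otherwise the minimum
-- width of a tree decomposition.
RankwidthAtLeast : ∀ {V} → Graph V → ℕ → Set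
RankwidthAtLeast {V} G r =
  r ≡ 0 ⊎ ((Σ V λ u → Σ V λ v → u ≢ v) × (∀ (T : TreeDecomp G) → WidthAtLeast T r))

-- Kinds of triples; `rel κ k J J'` is the prescribed adjacency between
-- u^J and v^J' (1-based indices J, J' ∈ {1..k}).

data Kind : Set where
  regMatch regAnti regCross : Kind
  expMatch expAnti expCross : Kind
  skewMatch skewAnti skewCross : Kind

isCross : Kind → Bool
isCross regCross = true
isCross expCross = true
isCross skewCross = true
isCross _ = false

data IsRegular : Kind → Set where
  rm : IsRegular regMatch
  ra : IsRegular regAnti
  rc : IsRegular regCross

data IsExpanding : Kind → Set where
  em : IsExpanding expMatch
  ea : IsExpanding expAnti
  ec : IsExpanding expCross

data IsSkew : Kind → Set where
  sm : IsSkew skewMatch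
  sa : IsSkew skewAnti
  sc : IsSkew skewCross

expPair : ℕ → ℕ → Bool
expPair J J' = (J' ≡ᵇ 2 * J) ∨ (J' ≡ᵇ 2 * J + 1)

rel : Kind → ℕ → ℕ → ℕ → Bool
rel regMatch  k J J' = J ≡ᵇ J'
rel regAnti   k J J' = not (J ≡ᵇ J')
rel regCross  k J J' = (k + 1) ≤ᵇ (J + J')
rel expMatch  k J J' = expPair J J'
rel expAnti   k J J' = not (expPair J J')
rel expCross  k J J' = (2 * k + 2) ≤ᵇ (2 * J + J')
rel skewMatch k J J' =
  if J ≤ᵇ ((k ∸ 2) / 4) then expPair J J'
  else if J ≤ᵇ ((3 * k + 2) / 4) then false
  else ((J' ≡ᵇ 2 * J ∸ k ∸ 2) ∨ (J' ≡ᵇ 2 * J ∸ k ∸ 1))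
rel skewAnti k J J' =
  if J ≤ᵇ ((k ∸ 2) / 4) then expPair J J'
  else if J ≤ᵇ ((3 * k + 2) / 4) then true
  else ((J' ≡ᵇ 2 * J ∸ k ∸ 2) ∨ (J' ≡ᵇ 2 * J ∸ k ∸ 1))
rel skewCross k J J' =
  if J ≤ᵇ ((k ∸ 2) / 4) then k ≤ᵇ (2 * J + J')
  else if J ≤ᵇ (k / 2) then (k / 2 + 1) ≤ᵇ J'
  else if J ≤ᵇ ((3 * k + 2) / 4) then (k / 2 ∸ 1) ≤ᵇ J'
  else (2 * k) ≤ᵇ (2 * J + J' ∸ 2)

-- Carousels. Vertex set X_1 ∪ … ∪ X_n is Fin n × Fin k: the vertex
-- x_i^j is (i-1 , j-1) (0-based indices).

Next : ∀ {n} → Fin n → Fin n → Set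
Next {n} a b = (toℕ a + 1 ≡ toℕ b) ⊎ ((toℕ a + 1 ≡ n) × (toℕ b ≡ 0))

CarouselWith : (n k : ℕ) → Graph (Fin n × Fin k) → (Fin n → Kind) → Set
CarouselWith n k G kinds =
  (∀ a → toℕ a ≡ 0 → kinds a ≡ regCross) ×
  (∀ a → 1 ≤ toℕ a → toℕ a + 2 ≤ n → IsRegular (kinds a)) ×
  (∀ a b → Next a b → ∀ (j j' : Fin k) →
     adj G (a , j) (b , j') ≡ rel (kinds a) k (suc (toℕ j)) (suc (toℕ j')))

evenK : ℕ → ℕ
evenK s = 2 ^ s ∸ 1

oddK : ℕ → ℕ
oddK s = 2 * (2 ^ s ∸ 1)

EvenCarousel : (n s : ℕ) → Graph (Fin n × Fin (evenK s)) → Set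
EvenCarousel n s G =
  Σ (Fin n → Kind) λ kinds →
    CarouselWith n (evenK s) G kinds ×
    (∀ a → toℕ a + 1 ≡ n → IsExpanding (kinds a)) ×
    (countTrue (λ a → isCross (kinds a)) % 2 ≡ 0)

OddCarousel : (n s : ℕ) → Graph (Fin n × Fin (oddK s)) → Set
OddCarousel n s G =
  Σ (Fin n → Kind) λ kinds →
    CarouselWith n (oddK s) G kinds ×
    (∀ a → toℕ a + 1 ≡ n → IsSkew (kinds a)) ×
    (countTrue (λ a → isCross (kinds a)) % 2 ≡ 1)

{-# OPTIONS --safe #-}
module Submission where

-- Colour the vertices by the two sides of a tree edge. If a triple contains pairs (u i, w i) along which its
-- adjacency matrix is triangular, or complementary to a triangular matrix, then many pairs with two different
-- colours force large cut-rank. Every regular, expanding or skew triple is covered by boundedly many such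
-- families, so in small cut-rank the colouring of X_1 is, up to boundedly many exceptions, constant along
-- i ~ i + 1 (from the crossing between X_1 and X_2) and along i ~ 2i, 2i + 1 (going once round the carousel;
-- the parity of the number of cross triples makes the orders match). Exceptions being few, some window
-- [2^l, 2^(l+2)) of X_1 has one colour, which all but a small fraction of its descendants inherit. Hence every
-- edge of a tree of small width splits X_1 very unevenly, which is impossible in a cubic tree.

open import Defs
open import Data.Bool using (Bool; true; false; not; _∧_; _∨_; _xor_; if_then_else_)
open import Data.Bool.Properties using (T-≡; ¬-not; ∧-distribˡ-xor; ∧-zeroʳ; ∨-zeroʳ; not-involutive; xor-assoc; xor-comm; xor-identityʳ; xor-inverseˡ; xor-same)
open import Data.Bool.Solver using (module xor-∧-Solver)
open import Data.Empty using (⊥; ⊥-elim)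
open import Data.Fin using (Fin; toℕ; fromℕ<) renaming (zero to fz; suc to fs)
import Data.Fin.Properties as Fin
open import Data.List using (List; []; _∷_; _∷ʳ_; length; lookup; map; take)
open import Data.List.Membership.Propositional using (_∈_; find)
open import Data.List.Membership.Propositional.Properties using (∈-lookup; ∈-map⁺; ∈-map⁻)
open import Data.List.Properties using (length-map; length-take)
open import Data.List.Relation.Unary.All as All using (All; []; _∷_)
import Data.List.Relation.Unary.All.Properties as All
open import Data.List.Relation.Unary.AllPairs as AllPairs using (AllPairs; []; _∷_)
import Data.List.Relation.Unary.AllPairs.Properties as AllPairs
open import Data.List.Relation.Unary.Any as Any using (Any; here; there)
open import Data.Nat
open import Data.Nat.DivMod using (_mod_; m%n<n; m*n/n≡m; m<n⇒m%n≡m)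
open import Data.Nat.Properties
open import Data.Nat.Solver using (module +-*-Solver)
open import Data.Product using (∃; _×_; _,_; proj₁; proj₂)
open import Data.Sum using (_⊎_; inj₁; inj₂)
open import Function using (_∘_; flip; id)
open import Function.Bundles using (Equivalence)
open import Relation.Binary.PropositionalEquality
open import Relation.Nullary using (¬_; yes; no; does; contradiction)
open import Relation.Nullary.Decidable using (_×-dec_)

-- Counting

𝟙 : Bool → ℕ
𝟙 b = if b then 1 else 0

𝟙-or : ∀ b c d → (b ≡ true → c ≡ true ⊎ d ≡ true) → 𝟙 b ≤ 𝟙 c + 𝟙 d
𝟙-or false c d p = z≤n
𝟙-or true true d p = s≤s z≤n
𝟙-or true false true p = s≤s z≤n
𝟙-or true false false p with p refl
... | inj₁ ()
... | inj₂ ()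

cnt : (ℕ → Bool) → ℕ → ℕ
cnt f zero = 0
cnt f (suc x) = 𝟙 (f x) + cnt f x

+-exchange : ∀ a b c d → (a + b) + (c + d) ≡ (a + c) + (b + d)
+-exchange = solve 4 (λ a b c d → (a :+ b) :+ (c :+ d) := (a :+ c) :+ (b :+ d)) refl
  where open +-*-Solver

cnt-or : ∀ {f g h} x → (∀ i → i < x → f i ≡ true → g i ≡ true ⊎ h i ≡ true) → cnt f x ≤ cnt g x + cnt h x
cnt-or zero p = z≤n
cnt-or {f} {g} {h} (suc x) p =
  ≤-trans (+-mono-≤ (𝟙-or (f x) (g x) (h x) (p x ≤-refl)) (cnt-or x λ i i<x → p i (m<n⇒m<1+n i<x)))
          (≤-reflexive (+-exchange (𝟙 (g x)) _ _ _))

cnt-empty : ∀ {f} x → (∀ i → i < x → ¬ f i ≡ true) → cnt f x ≡ 0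
cnt-empty zero p = refl
cnt-empty {f} (suc x) p with f x in eq
... | true = contradiction eq (p x ≤-refl)
... | false = cnt-empty x λ i i<x → p i (m<n⇒m<1+n i<x)

cnt-≤ : ∀ {f g} x → (∀ i → i < x → f i ≡ true → g i ≡ true) → cnt f x ≤ cnt g x
cnt-≤ {f} {g} x p = subst (cnt f x ≤_) (trans (cong (cnt g x +_) (cnt-empty {λ _ → false} x λ _ _ ())) (+-identityʳ _))
  (cnt-or x λ i i<x fi → inj₁ (p i i<x fi))

cnt-mono : ∀ f {x y} → x ≤ y → cnt f x ≤ cnt f y
cnt-mono f {x} x≤y = go (≤⇒≤′ x≤y)
  where
  go : ∀ {y} → x ≤′ y → cnt f x ≤ cnt f y
  go ≤′-refl = ≤-refl
  go (≤′-step p) = ≤-trans (go p) (m≤n+m _ _)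

cnt-suc : ∀ f x → cnt f (suc x) ≡ 𝟙 (f 0) + cnt (f ∘ suc) x
cnt-suc f zero = refl
cnt-suc f (suc x) = begin
  𝟙 (f (suc x)) + cnt f (suc x)                     ≡⟨ cong (𝟙 (f (suc x)) +_) (cnt-suc f x) ⟩
  𝟙 (f (suc x)) + (𝟙 (f 0) + cnt (f ∘ suc) x)       ≡⟨ +-assoc (𝟙 (f (suc x))) _ _ ⟨
  𝟙 (f (suc x)) + 𝟙 (f 0) + cnt (f ∘ suc) x         ≡⟨ cong (_+ cnt (f ∘ suc) x) (+-comm (𝟙 (f (suc x))) _) ⟩
  𝟙 (f 0) + 𝟙 (f (suc x)) + cnt (f ∘ suc) x         ≡⟨ +-assoc (𝟙 (f 0)) _ _ ⟩
  𝟙 (f 0) + cnt (f ∘ suc) (suc x)                   ∎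
  where open ≡-Reasoning

𝟙≤1 : ∀ b → 𝟙 b ≤ 1
𝟙≤1 true = ≤-refl
𝟙≤1 false = z≤n

cnt-suc-≤ : ∀ f x → cnt f (suc x) ≤ suc (cnt (f ∘ suc) x)
cnt-suc-≤ f x = ≤-trans (≤-reflexive (cnt-suc f x)) (+-monoˡ-≤ _ (𝟙≤1 (f 0)))

cnt-suc-≥ : ∀ f x → cnt (f ∘ suc) x ≤ cnt f (suc x)
cnt-suc-≥ f x = ≤-trans (m≤n+m _ _) (≤-reflexive (sym (cnt-suc f x)))

countTrue-cnt : ∀ f x → countTrue {x} (f ∘ toℕ) ≡ cnt f x
countTrue-cnt f zero = refl
countTrue-cnt f (suc x) = trans (cong (𝟙 (f 0) +_) (countTrue-cnt (f ∘ suc) x)) (sym (cnt-suc f x))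

cnt-double : ∀ f x → cnt f (2 * x) ≡ cnt (λ i → f (2 * i)) x + cnt (λ i → f (1 + 2 * i)) x
cnt-double f zero = refl
cnt-double f (suc x) = trans (cong (cnt f) (*-suc 2 x)) (trans (cong (λ y → a + (b + y)) (cnt-double f x))
  (solve 4 (λ a b c d → a :+ (b :+ (c :+ d)) := (b :+ c) :+ (a :+ d)) refl
    a b (cnt (λ i → f (2 * i)) x) (cnt (λ i → f (1 + 2 * i)) x)))
  where
  open +-*-Solver
  a = 𝟙 (f (1 + 2 * x))
  b = 𝟙 (f (2 * x))

≤ᵇ-true : ∀ {m n} → m ≤ n → (m ≤ᵇ n) ≡ true
≤ᵇ-true p = Equivalence.to T-≡ (≤⇒≤ᵇ p)

true-≤ᵇ : ∀ {m n} → (m ≤ᵇ n) ≡ true → m ≤ n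
true-≤ᵇ {m} p = ≤ᵇ⇒≤ m _ (Equivalence.from T-≡ p)

≤ᵇ-false : ∀ {m n} → n < m → (m ≤ᵇ n) ≡ false
≤ᵇ-false {m} {n} p with m ≤ᵇ n in eq
... | false = refl
... | true = contradiction (true-≤ᵇ eq) (<⇒≱ p)

cnt-< : ∀ a x → cnt (λ i → not (a ≤ᵇ i)) x ≤ a
cnt-< a zero = z≤n
cnt-< a (suc x) with a ≤? x
... | yes a≤x rewrite ≤ᵇ-true a≤x = cnt-< a x
... | no a≰x = ≤-trans (cnt-length (suc x)) (≰⇒> a≰x)
  where
  cnt-length : ∀ {f} x → cnt f x ≤ x
  cnt-length zero = z≤n
  cnt-length {f} (suc x) = +-mono-≤ (𝟙≤1 (f x)) (cnt-length x)

cnt-flat : ∀ f {x y i} → cnt f x ≡ cnt f y → x ≤ i → i < y → f i ≡ false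
cnt-flat f {x} {y} {i} eq x≤i i<y with f i in fi
... | false = refl
... | true = contradiction (≤-trans (s≤s (cnt-mono f x≤i)) (≤-trans (≤-reflexive (cong (λ b → 𝟙 b + cnt f i) (sym fi))) (cnt-mono f i<y)))
               (<-irrefl eq)

-- Two-colourings of the naturals under doubling

xor-trans : ∀ a b {c} → a xor c ≡ true → a xor b ≡ true ⊎ b xor c ≡ true
xor-trans true true p = inj₂ p
xor-trans true false p = inj₁ refl
xor-trans false true p = inj₁ refl
xor-trans false false p = inj₂ p

xor-swap : ∀ a b → a xor b ≡ true → b xor a ≡ true
xor-swap true false p = refl
xor-swap false true p = refl

xor-false : ∀ {a b} → a xor b ≡ false → a ≡ b
xor-false {true} {true} p = refl
xor-false {false} {false} p = refl

xor-irrefl : ∀ {a b} → a ≡ b → ¬ a xor b ≡ true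
xor-irrefl {true} refl ()
xor-irrefl {false} refl ()

-- A step that does not stall raises `F` by at least one, so `W` such steps would lift `F W` to at
-- least `F 0 + W`.
stall : ∀ (F : ℕ → ℕ) → (∀ w → F w ≤ F (suc w)) → ∀ W → F W < F 0 + W → ∃ λ w → w < W × F w ≡ F (suc w)
stall F mono zero p = contradiction p (<-irrefl (sym (+-identityʳ (F 0))))
stall F mono (suc W) p with F W ≟ F (suc W)
... | yes eq = W , ≤-refl , eq
... | no neq = let w , w<W , eq = stall F mono W (s≤s⁻¹ (≤-trans (s≤s (≤∧≢⇒< (mono W) neq)) (≤-trans p (≤-reflexive (+-suc (F 0) W)))))
               in w , m<n⇒m<1+n w<W , eq

n<2^n : ∀ n → n < 2 ^ n
n<2^n zero = s≤s z≤n
n<2^n (suc n) = ≤-trans (+-mono-≤ (m^n>0 2 n) (n<2^n n)) (≤-reflexive (cong (2 ^ n +_) (sym (+-identityʳ _))))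

halve : ∀ {A i e} → e ≤ 1 → 2 * A ≤ e + 2 * i → A ≤ i
halve {A} {i} {e} e≤1 p with A ≤? i
... | yes q = q
... | no q = contradiction (≤-trans (*-monoʳ-≤ 2 (≰⇒> q)) (≤-trans p (+-monoˡ-≤ _ e≤1)))
               (<⇒≱ (≤-reflexive (sym (*-suc 2 i))))

∧-true : ∀ {a b} → a ∧ b ≡ true → a ≡ true × b ≡ true
∧-true {true} p = refl , p

-- `d σ i` is the colour of index `i` on sheet `σ`; its children are `2 * i` and `1 + 2 * i` on the
-- opposite sheet. `N` bounds the disagreements between parents and even children, and likewise odd
-- children, from either sheet.
module Propagation (d : Bool → ℕ → Bool) (q N A : ℕ)
  (even : ∀ σ → cnt (λ i → d σ i xor d (not σ) (2 * i)) q ≤ N)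
  (odd  : ∀ σ → cnt (λ i → d σ i xor d (not σ) (1 + 2 * i)) q ≤ N)
  (window : ∀ i → A ≤ i → i < 2 * (2 * A) → d false i ≡ d false A)
  where

  γ : Bool
  γ = d false A

  -- The cuts are such that a wrongly coloured index above the cut has its parent above the cut.
  -- From sheet `true`, `2 * A` halves to `A`. On sheet `false` the window forces a wrong index up
  -- to at least `2 * (2 * A)`, which halves to `2 * A`.
  cut : Bool → ℕ
  cut false = A
  cut true = 2 * A

  bad : Bool → ℕ → Bool
  bad σ i = (cut σ ≤ᵇ i) ∧ (d σ i xor γ)

  bad-step : ∀ σ e i → e ≤ 1 → bad (not σ) (e + 2 * i) ≡ true →
    bad σ i ≡ true ⊎ d σ i xor d (not σ) (e + 2 * i) ≡ true
  bad-step σ e i e≤1 p with ∧-true p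
  ... | c , x with xor-trans (d (not σ) (e + 2 * i)) (d σ i) x
  ... | inj₁ y = inj₂ (xor-swap (d (not σ) (e + 2 * i)) _ y)
  ... | inj₂ y = inj₁ (cong₂ _∧_ (≤ᵇ-true (above σ c x)) y)
    where
    above : ∀ σ → (cut (not σ) ≤ᵇ e + 2 * i) ≡ true → d (not σ) (e + 2 * i) xor γ ≡ true → cut σ ≤ i
    above false c _ = halve e≤1 (true-≤ᵇ c)
    above true c x with 2 * (2 * A) ≤? e + 2 * i
    ... | yes r = halve e≤1 r
    ... | no r = contradiction x (xor-irrefl (window _ (true-≤ᵇ c) (≰⇒> r)))

  double-≤ : ∀ σ x → x ≤ q → cnt (bad (not σ)) (2 * x) ≤ 2 * cnt (bad σ) x + 2 * N
  double-≤ σ x x≤q = begin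
    cnt (bad (not σ)) (2 * x)
      ≡⟨ cnt-double (bad (not σ)) x ⟩
    cnt (λ i → bad (not σ) (2 * i)) x + cnt (λ i → bad (not σ) (1 + 2 * i)) x
      ≤⟨ +-mono-≤ (cnt-or x λ i _ → bad-step σ 0 i z≤n) (cnt-or x λ i _ → bad-step σ 1 i ≤-refl) ⟩
    (B + cnt (λ i → d σ i xor d (not σ) (2 * i)) x) + (B + cnt (λ i → d σ i xor d (not σ) (1 + 2 * i)) x)
      ≤⟨ +-mono-≤ (+-monoʳ-≤ B (≤-trans (cnt-mono _ x≤q) (even σ))) (+-monoʳ-≤ B (≤-trans (cnt-mono _ x≤q) (odd σ))) ⟩
    (B + N) + (B + N)
      ≡⟨ solve 2 (λ b n → (b :+ n) :+ (b :+ n) := con 2 :* b :+ con 2 :* n) refl B N ⟩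
    2 * B + 2 * N ∎
    where
    open ≤-Reasoning
    open +-*-Solver
    B = cnt (bad σ) x

  bad-below : ∀ σ i → i < 2 * A → ¬ bad σ i ≡ true
  bad-below false i i<2A p with ∧-true p
  ... | c , x = xor-irrefl (window i (true-≤ᵇ c) (<-≤-trans i<2A (m≤n*m (2 * A) 2))) x
  bad-below true i i<2A p = <⇒≱ i<2A (true-≤ᵇ (proj₁ (∧-true p)))

  -- The added `2 * N` turns the recursion of `double-≤` into pure doubling. It starts at `2 * N`,
  -- since neither sheet has a bad index below `2 * A`.
  growth : ∀ t σ → 2 ^ t * (2 * A) ≤ 2 * q → cnt (bad σ) (2 ^ t * (2 * A)) + 2 * N ≤ 2 ^ t * (2 * N)
  growth zero σ p = ≤-reflexive (trans (cong (_+ 2 * N) (trans (cong (cnt (bad σ)) (*-identityˡ (2 * A))) (cnt-empty (2 * A) (bad-below σ))))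
                                 (sym (*-identityˡ (2 * N))))
  growth (suc t) σ p = begin
    cnt (bad σ) (2 ^ suc t * (2 * A)) + 2 * N ≡⟨ cong (λ y → cnt (bad σ) y + 2 * N) (*-assoc 2 (2 ^ t) (2 * A)) ⟩
    cnt (bad σ) (2 * x) + 2 * N ≡⟨ cong (λ τ → cnt (bad τ) (2 * x) + 2 * N) (sym (not-involutive σ)) ⟩
    cnt (bad (not (not σ))) (2 * x) + 2 * N ≤⟨ +-monoˡ-≤ (2 * N) (double-≤ (not σ) x x≤q) ⟩
    2 * B + 2 * N + 2 * N ≡⟨ solve 2 (λ b n → con 2 :* b :+ n :+ n := con 2 :* (b :+ n)) refl B (2 * N) ⟩
    2 * (B + 2 * N) ≤⟨ *-monoʳ-≤ 2 (growth t (not σ) (≤-trans x≤q (m≤n*m q 2))) ⟩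
    2 * (2 ^ t * (2 * N)) ≡⟨ *-assoc 2 (2 ^ t) (2 * N) ⟨
    2 ^ suc t * (2 * N) ∎
    where
    open ≤-Reasoning
    open +-*-Solver
    x = 2 ^ t * (2 * A)
    B = cnt (bad (not σ)) x
    x≤q : x ≤ q
    x≤q = *-cancelˡ-≤ 2 (≤-trans (≤-reflexive (sym (*-assoc 2 (2 ^ t) (2 * A)))) p)

  -- The indices below `2 * A` are written off wholesale; any other wrongly coloured index lies
  -- above the cut and is bad.
  minority : ∀ t → 2 ^ t * (2 * A) ≡ 2 * q → cnt (λ i → d false i xor γ) (2 * q) ≤ 2 ^ t * (2 * N) + 2 * A
  minority t eq = begin
    cnt (λ i → d false i xor γ) (2 * q)
      ≤⟨ cnt-or (2 * q) (λ i _ → split i) ⟩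
    cnt (bad false) (2 * q) + cnt (λ i → not (2 * A ≤ᵇ i)) (2 * q)
      ≤⟨ +-mono-≤ (≤-trans (≤-trans (≤-reflexive (cong (cnt (bad false)) (sym eq))) (m≤m+n _ (2 * N))) (growth t false (≤-reflexive eq)))
                  (cnt-< (2 * A) (2 * q)) ⟩
    2 ^ t * (2 * N) + 2 * A ∎
    where
    open ≤-Reasoning
    split : ∀ i → d false i xor γ ≡ true → bad false i ≡ true ⊎ not (2 * A ≤ᵇ i) ≡ true
    split i p with 2 * A ≤? i
    ... | no r = inj₂ (cong not (≤ᵇ-false (≰⇒> r)))
    ... | yes r = inj₁ (cong₂ _∧_ (≤ᵇ-true (≤-trans (m≤n*m A 2) r)) p)

-- Equal counts leave no colour change between `x` and `y`, so the colour of `x` is carried upwards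
-- one index at a time.
constant-on : ∀ (c : ℕ → Bool) {x y} → cnt (λ i → c i xor c (suc i)) x ≡ cnt (λ i → c i xor c (suc i)) y →
  ∀ i → x ≤ i → i < y → c i ≡ c x
constant-on c {x} {y} eq i x≤i = go (≤⇒≤′ x≤i)
  where
  go : ∀ {i} → x ≤′ i → i < y → c i ≡ c x
  go ≤′-refl _ = refl
  go {suc i} (≤′-step p) i<y =
    trans (sym (xor-false (cnt-flat _ eq (≤′⇒≤ p) (<⇒≤ i<y)))) (go p (<⇒≤ i<y))

-- Some window [2^l, 2^(l+2)) of sheet false is monochromatic. Two levels are needed since children lie on the
-- other sheet: from level l + 1 on, every chain of parents, on either sheet, meets level l or l + 1 of sheet false.
almost-constant : ∀ (d : Bool → ℕ → Bool) (N : ℕ) → let q = 2 ^ (8 + 3 * N) in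
  (∀ σ → cnt (λ i → d σ i xor d (not σ) (2 * i)) q ≤ N) →
  (∀ σ → cnt (λ i → d σ i xor d (not σ) (1 + 2 * i)) q ≤ N) →
  cnt (λ i → d false i xor d false (suc i)) q ≤ N →
  ∃ λ γ → cnt (λ i → d false i xor γ) (2 * q) ≤ 2 ^ (6 + 3 * N)
almost-constant d N even odd shift
  -- The number of colour changes below `2 ^ (4 + N + 2 * w)` is still at most `N` at `w = suc N`,
  -- so one of the `suc N` successive ranges, each from a bound to four times that bound, contains
  -- no change.
  with stall (λ w → cnt (λ i → d false i xor d false (suc i)) (2 ^ (4 + N + 2 * w)))
             (λ w → cnt-mono _ (^-monoʳ-≤ 2 (+-monoʳ-≤ (4 + N) (*-monoʳ-≤ 2 (n≤1+n w)))))
             (suc N)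
             (≤-trans (s≤s (≤-trans (cnt-mono _ (^-monoʳ-≤ 2 top)) shift)) (m≤n+m (suc N) _))
  where
  top : 4 + N + 2 * suc N ≤ 8 + 3 * N
  top = ≤-trans (≤-reflexive (solve 1 (λ n → con 4 :+ n :+ con 2 :* (con 1 :+ n) := con 6 :+ con 3 :* n) refl N)) (m≤n+m _ 2)
    where open +-*-Solver
... | w , s≤s w≤N , eq = γ , (begin
  cnt (λ i → d false i xor γ) (2 * q) ≤⟨ minority t total ⟩
  2 ^ t * (2 * N) + 2 * A ≤⟨ +-mono-≤ left right ⟩
  2 ^ (5 + 3 * N) + 2 ^ (5 + 3 * N) ≡⟨ cong (2 ^ (5 + 3 * N) +_) (sym (+-identityʳ _)) ⟩
  2 ^ (6 + 3 * N) ∎)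
  where
  open ≤-Reasoning
  open +-*-Solver
  q = 2 ^ (8 + 3 * N)
  w′ = N ∸ w
  w+w′ : w + w′ ≡ N
  w+w′ = m+[n∸m]≡n w≤N
  -- The summand `4 + N` makes `A` exceed `16 * N`, so inherited errors stay below a sixteenth of
  -- `2 * q`; the written-off indices are at most another sixteenth.
  A = 2 ^ (4 + N + 2 * w)
  -- The number of doublings from `2 * A` to `2 * q`.
  t = 4 + 2 * w′
  next : 2 * (2 * A) ≡ 2 ^ (4 + N + 2 * suc w)
  next = cong (2 ^_) (solve 2 (λ n w → con 1 :+ (con 1 :+ (con 4 :+ n :+ con 2 :* w)) := con 4 :+ n :+ con 2 :* (con 1 :+ w)) refl N w)
  open Propagation d q N A even odd
    (λ i A≤i i<4A → constant-on (d false) {A} {2 ^ (4 + N + 2 * suc w)} eq i A≤i (subst (i <_) next i<4A))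
  total : 2 ^ t * (2 * A) ≡ 2 * q
  total = trans (sym (^-distribˡ-+-* 2 t (5 + N + 2 * w)))
    (cong (2 ^_) (trans (solve 3 (λ n a b → con 4 :+ con 2 :* b :+ (con 5 :+ n :+ con 2 :* a) := con 9 :+ n :+ con 2 :* (a :+ b)) refl N w w′)
                 (trans (cong (λ y → 9 + N + 2 * y) w+w′) (solve 1 (λ n → con 9 :+ n :+ con 2 :* n := con 9 :+ con 3 :* n) refl N))))
  left : 2 ^ t * (2 * N) ≤ 2 ^ (5 + 3 * N)
  left = begin
    2 ^ t * (2 * N) ≤⟨ *-monoʳ-≤ (2 ^ t) (*-monoʳ-≤ 2 (<⇒≤ (n<2^n N))) ⟩
    2 ^ t * 2 ^ (1 + N) ≡⟨ ^-distribˡ-+-* 2 t (1 + N) ⟨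
    2 ^ (t + (1 + N)) ≤⟨ ^-monoʳ-≤ 2 (≤-trans (+-monoˡ-≤ (1 + N) (+-monoʳ-≤ 4 (*-monoʳ-≤ 2 (m∸n≤m N w))))
                           (≤-reflexive (solve 1 (λ n → con 4 :+ con 2 :* n :+ (con 1 :+ n) := con 5 :+ con 3 :* n) refl N))) ⟩
    2 ^ (5 + 3 * N) ∎
  right : 2 * A ≤ 2 ^ (5 + 3 * N)
  right = ^-monoʳ-≤ 2 (≤-trans (+-monoʳ-≤ (5 + N) (*-monoʳ-≤ 2 w≤N))
           (≤-reflexive (solve 1 (λ n → con 5 :+ n :+ con 2 :* n := con 5 :+ con 3 :* n) refl N)))

-- Cut-rank

xorSum-cong : ∀ {n} {f g : Fin n → Bool} → (∀ i → f i ≡ g i) → xorSum f ≡ xorSum g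
xorSum-cong {zero} p = refl
xorSum-cong {suc n} p = cong₂ _xor_ (p fz) (xorSum-cong (p ∘ fs))

xorSum-false : ∀ {n} {f : Fin n → Bool} → (∀ i → f i ≡ false) → xorSum f ≡ false
xorSum-false {zero} p = refl
xorSum-false {suc n} p rewrite p fz = xorSum-false (p ∘ fs)

xor-interchange : ∀ a b c d → (a xor b) xor (c xor d) ≡ (a xor c) xor (b xor d)
xor-interchange = solve 4 (λ a b c d → (a :+ b) :+ (c :+ d) := (a :+ c) :+ (b :+ d)) refl
  where open xor-∧-Solver

xorSum-xor : ∀ {n} (f g : Fin n → Bool) → xorSum (λ i → f i xor g i) ≡ xorSum f xor xorSum g
xorSum-xor {zero} f g = refl
xorSum-xor {suc n} f g = trans (cong ((f fz xor g fz) xor_) (xorSum-xor (f ∘ fs) (g ∘ fs))) (xor-interchange (f fz) _ _ _)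

nonzero? : ∀ {n} (S : Fin n → Bool) → (∃ λ i → S i ≡ true) ⊎ (∀ i → S i ≡ false)
nonzero? {zero} S = inj₂ λ ()
nonzero? {suc n} S with S fz in eq | nonzero? (S ∘ fs)
... | true | _ = inj₁ (fz , eq)
... | false | inj₁ (i , p) = inj₁ (fs i , p)
... | false | inj₂ p = inj₂ λ { fz → eq ; (fs i) → p i }

-- The column of the first selected row meets no other selected row.
triangular-independent : ∀ {N : ℕ → ℕ → Bool} ps → All (λ i → N i i ≡ true) ps → AllPairs (λ i j → N j i ≡ false) ps →
  (S : Fin (length ps) → Bool) → (∃ λ i → S i ≡ true) →
  ∃ λ c → c ∈ ps × xorSum (λ i → S i ∧ N (lookup ps i) c) ≡ true
triangular-independent [] _ _ S (() , _)
triangular-independent {N} (p ∷ ps) (d ∷ ds) (o ∷ os) S (i , Si) with S fz in S0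
... | true = p , here refl , cong₂ _xor_ d
      (xorSum-false λ j → trans (cong (S (fs j) ∧_) (All.lookup o (∈-lookup j))) (∧-zeroʳ (S (fs j))))
... | false with i
... | fz = contradiction (trans (sym S0) Si) λ ()
... | fs i′ with triangular-independent ps ds os (S ∘ fs) (i′ , Si)
... | c , c∈ , eq = c , there c∈ , eq

xor-cancel : ∀ a b → (a xor b) xor b ≡ a
xor-cancel true true = refl
xor-cancel true false = refl
xor-cancel false true = refl
xor-cancel false false = refl

-- The other strict triangle is unconstrained. For `b = false` the matrix has full rank `x`; for
-- `b = true` it is the complement of such a matrix, which costs at most one in rank.
data Triangular (M : ℕ → ℕ → Bool) (x : ℕ) : Set where
  triangular : ∀ b → (∀ i → i < x → M i i ≡ not b) →
    (∀ i j → i < j → j < x → M i j ≡ b) ⊎ (∀ i j → i < j → j < x → M j i ≡ b) → Triangular M x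

transpose : ∀ {M x} → Triangular M x → Triangular (flip M) x
transpose (triangular b d (inj₁ o)) = triangular b d (inj₂ o)
transpose (triangular b d (inj₂ o)) = triangular b d (inj₁ o)

-- Two orders are needed because `rank-triangular` wants the value `b` in later rows of earlier
-- columns: decreasing order achieves this for a constant upper triangle, increasing order for a
-- lower one.
selectDown selectUp : (ℕ → Bool) → ℕ → List ℕ
selectDown f zero = []
selectDown f (suc x) = if f x then x ∷ selectDown f x else selectDown f x
selectUp f zero = []
selectUp f (suc x) = if f x then selectUp f x ∷ʳ x else selectUp f x

Selected : (ℕ → Bool) → ℕ → ℕ → Set
Selected f x i = i < x × f i ≡ true

weaken : ∀ {f x i} → Selected f x i → Selected f (suc x) i
weaken (p , q) = m<n⇒m<1+n p , q

selectDown-selected : ∀ f x → All (Selected f x) (selectDown f x)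
selectDown-selected f zero = []
selectDown-selected f (suc x) with f x in eq
... | true = (≤-refl , eq) ∷ All.map (weaken {f}) (selectDown-selected f x)
... | false = All.map (weaken {f}) (selectDown-selected f x)

selectUp-selected : ∀ f x → All (Selected f x) (selectUp f x)
selectUp-selected f zero = []
selectUp-selected f (suc x) with f x in eq
... | true = All.∷ʳ⁺ (All.map (weaken {f}) (selectUp-selected f x)) (≤-refl , eq)
... | false = All.map (weaken {f}) (selectUp-selected f x)

selectDown-sorted : ∀ f x → AllPairs _>_ (selectDown f x)
selectDown-sorted f zero = []
selectDown-sorted f (suc x) with f x
... | true = All.map proj₁ (selectDown-selected f x) ∷ selectDown-sorted f x
... | false = selectDown-sorted f x

selectUp-sorted : ∀ f x → AllPairs _<_ (selectUp f x)
selectUp-sorted f zero = []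
selectUp-sorted f (suc x) with f x
... | true = AllPairs.++⁺ (selectUp-sorted f x) ([] ∷ []) (All.map (λ s → proj₁ s ∷ []) (selectUp-selected f x))
... | false = selectUp-sorted f x

length-selectDown : ∀ f x → length (selectDown f x) ≡ cnt f x
length-selectDown f zero = refl
length-selectDown f (suc x) with f x
... | true = cong suc (length-selectDown f x)
... | false = length-selectDown f x

length-∷ʳ : ∀ {A : Set} (xs : List A) {x} → length (xs ∷ʳ x) ≡ suc (length xs)
length-∷ʳ [] = refl
length-∷ʳ (y ∷ xs) = cong suc (length-∷ʳ xs)

length-selectUp : ∀ f x → length (selectUp f x) ≡ cnt f x
length-selectUp f zero = refl
length-selectUp f (suc x) with f x
... | true = trans (length-∷ʳ (selectUp f x)) (cong suc (length-selectUp f x))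
... | false = length-selectUp f x

AllPairs-zip : ∀ {P : ℕ → Set} {R Q : ℕ → ℕ → Set} → (∀ {i j} → P i → P j → R i j → Q i j) →
  ∀ {xs} → All P xs → AllPairs R xs → AllPairs Q xs
AllPairs-zip f [] [] = []
AllPairs-zip f (p ∷ ps) (r ∷ rs) = All.zipWith (λ (pj , rij) → f p pj rij) (ps , r) ∷ AllPairs-zip f ps rs

module CutRank {V : Set} (G : Graph V) (r : ℕ) (Y Z : V → Set)
  (col : V → Bool) (inY : ∀ v → col v ≡ true → Y v) (inZ : ∀ v → col v ≡ false → Z v) where

  module _ (U W : ℕ → V) where

    M : ℕ → ℕ → Bool
    M i j = adj G (U i) (W j)

    -- The extra column p makes the rows of M independent even when b = true, where M is
    -- the complement of a triangular matrix: it detects the sets of rows of odd size.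
    rank-triangular : ∀ b p ps → All (λ i → M i i ≡ not b) (p ∷ ps) → AllPairs (λ i j → M j i ≡ b) (p ∷ ps) →
      All (λ i → Y (U i)) ps → All (λ i → Z (W i)) (p ∷ ps) → RankAtLeast G Y Z (length ps)
    rank-triangular b p ps (_ ∷ ds) (o ∷ os) ys (z ∷ zs) =
      U ∘ lookup ps , (λ i → All.lookup ys (∈-lookup i)) , independent
      where
      not-xor : ∀ {a} → a ≡ not b → a xor b ≡ true
      not-xor refl = xor-inverseˡ b
      shifted : ∀ S c → xorSum (λ i → S i ∧ M (lookup ps i) c) ≡
        xorSum (λ i → S i ∧ (M (lookup ps i) c xor b)) xor xorSum (λ i → S i ∧ b)
      shifted S c = trans (xorSum-cong λ i → trans (cong (S i ∧_) (sym (xor-cancel _ b))) (∧-distribˡ-xor (S i) _ b)) (xorSum-xor {length ps} _ _)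
      independent : ∀ S → (∃ λ i → S i ≡ true) →
        ∃ λ v → Z v × xorSum (λ i → S i ∧ adj G (U (lookup ps i)) v) ≡ true
      independent S nz with xorSum (λ i → S i ∧ b) in parity
      ... | true = W p , z , trans (xorSum-cong λ i → cong (S i ∧_) (All.lookup o (∈-lookup i))) parity
      ... | false with triangular-independent {λ i j → M i j xor b} ps (All.map not-xor ds) (AllPairs.map (λ { refl → xor-same b }) os) S nz
      ... | c , c∈ , eq = W c , All.lookup zs c∈ , trans (shifted S c) (cong₂ _xor_ eq parity)

    rank-selected : ∀ b ps → All (λ i → M i i ≡ not b) ps → AllPairs (λ i j → M j i ≡ b) ps →
      All (λ i → Y (U i)) ps → All (λ i → Z (W i)) ps → r < length ps → RankAtLeast G Y Z r
    rank-selected b (p ∷ ps) (d ∷ ds) (o ∷ os) (y ∷ ys) (z ∷ zs) (s≤s r≤) =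
      subst (RankAtLeast G Y Z) (trans (length-take r ps) (m≤n⇒m⊓n≡m r≤))
        (rank-triangular b p (take r ps) (d ∷ All.take⁺ r ds) (All.take⁺ r o ∷ AllPairs.take⁺ r os) (All.take⁺ r ys) (z ∷ All.take⁺ r zs))

    -- More than `r` selected pairs would span a triangular submatrix between the two sides. One
    -- pair gives up its row and serves as the parity column; `r` independent rows remain.
    few-crossings : ∀ x → Triangular M x →
      cnt (λ i → col (U i) ∧ not (col (W i))) x ≤ r ⊎ RankAtLeast G Y Z r
    few-crossings x (triangular b diag off) with cnt (λ i → col (U i) ∧ not (col (W i))) x ≤? r
    ... | yes p = inj₁ p
    ... | no p = inj₂ (go off)
      where
      f = λ i → col (U i) ∧ not (col (W i))
      y : ∀ {i} → Selected f x i → Y (U i)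
      y {i} (_ , fi) = inY (U i) (proj₁ (∧-true fi))
      z : ∀ {i} → Selected f x i → Z (W i)
      z {i} (_ , fi) = inZ (W i) (not-true (proj₂ (∧-true {col (U i)} fi)))
        where
        not-true : ∀ {a} → not a ≡ true → a ≡ false
        not-true {false} _ = refl
      go : (∀ i j → i < j → j < x → M i j ≡ b) ⊎ (∀ i j → i < j → j < x → M j i ≡ b) → RankAtLeast G Y Z r
      go (inj₁ o) = rank-selected b (selectDown f x) (All.map (λ s → diag _ (proj₁ s)) sel)
        (AllPairs-zip (λ si _ j<i → o _ _ j<i (proj₁ si)) sel (selectDown-sorted f x))
        (All.map y sel) (All.map z sel) (≤-trans (≰⇒> p) (≤-reflexive (sym (length-selectDown f x))))
        where sel = selectDown-selected f x
      go (inj₂ o) = rank-selected b (selectUp f x) (All.map (λ s → diag _ (proj₁ s)) sel)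
        (AllPairs-zip (λ _ sj i<j → o _ _ i<j (proj₁ sj)) sel (selectUp-sorted f x))
        (All.map y sel) (All.map z sel) (≤-trans (≰⇒> p) (≤-reflexive (sym (length-selectUp f x))))
        where sel = selectUp-selected f x

  -- A two-coloured pair crosses in one of two directions. The second direction is the first one for
  -- the transposed matrix, whence the factor 2.
  few-violations : ∀ (U W : ℕ → V) x → Triangular (M U W) x →
    cnt (λ i → col (U i) xor col (W i)) x ≤ 2 * r ⊎ RankAtLeast G Y Z r
  few-violations U W x t with few-crossings U W x t | few-crossings W U x (transposed t)
    where
    transposed : Triangular (M U W) x → Triangular (M W U) x
    transposed t with transpose t
    ... | triangular b d (inj₁ o) = triangular b (λ i p → trans (adj-sym G _ _) (d i p)) (inj₁ λ i j p q → trans (adj-sym G _ _) (o i j p q))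
    ... | triangular b d (inj₂ o) = triangular b (λ i p → trans (adj-sym G _ _) (d i p)) (inj₂ λ i j p q → trans (adj-sym G _ _) (o i j p q))
  ... | inj₂ rk | _ = inj₂ rk
  ... | _ | inj₂ rk = inj₂ rk
  ... | inj₁ p | inj₁ q = inj₁ (≤-trans (cnt-or x λ i _ → split (col (U i)) (col (W i)))
                           (≤-trans (+-mono-≤ p q) (≤-reflexive (cong (r +_) (sym (+-identityʳ r))))))
    where
    split : ∀ a b → a xor b ≡ true → a ∧ not b ≡ true ⊎ b ∧ not a ≡ true
    split true false _ = inj₁ refl
    split false true _ = inj₂ refl

-- Cubic trees

countTrue-or : ∀ {n} {f g h : Fin n → Bool} → (∀ i → f i ≡ true → g i ≡ true ⊎ h i ≡ true) →
  countTrue f ≤ countTrue g + countTrue h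
countTrue-or {zero} p = z≤n
countTrue-or {suc n} {f} {g} {h} p =
  ≤-trans (+-mono-≤ (𝟙-or (f fz) (g fz) (h fz) (p fz)) (countTrue-or (p ∘ fs)))
          (≤-reflexive (+-exchange (𝟙 (g fz)) _ _ _))

countTrue-≤ : ∀ {n} {f g : Fin n → Bool} → (∀ i → f i ≡ true → g i ≡ true) → countTrue f ≤ countTrue g
countTrue-≤ {zero} p = z≤n
countTrue-≤ {suc n} {f} {g} p = +-mono-≤ (𝟙-mono (f fz) (g fz) (p fz)) (countTrue-≤ (p ∘ fs))
  where
  𝟙-mono : ∀ a b → (a ≡ true → b ≡ true) → 𝟙 a ≤ 𝟙 b
  𝟙-mono false b p = z≤n
  𝟙-mono true b p rewrite p refl = ≤-refl

countTrue-< : ∀ {n} {f g : Fin n → Bool} → (∀ i → f i ≡ true → g i ≡ true) →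
  ∀ {i} → f i ≡ false → g i ≡ true → countTrue f < countTrue g
countTrue-< {f = f} {g} p {fz} fi gi rewrite fi | gi = s≤s (countTrue-≤ (p ∘ fs))
countTrue-< {f = f} {g} p {fs i} fi gi with f fz in f0 | g fz in g0
... | false | false = countTrue-< (p ∘ fs) fi gi
... | false | true = m<n⇒m<1+n (countTrue-< (p ∘ fs) fi gi)
... | true | true = s≤s (countTrue-< (p ∘ fs) fi gi)
... | true | false = contradiction (trans (sym g0) (p fz f0)) λ ()

countTrue-all : ∀ {n} {f : Fin n → Bool} → (∀ i → f i ≡ true) → countTrue f ≡ n
countTrue-all {zero} p = refl
countTrue-all {suc n} p rewrite p fz = cong suc (countTrue-all (p ∘ fs))

countTrue-bound : ∀ {n} (f : Fin n → Bool) → countTrue f ≤ n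
countTrue-bound {zero} f = z≤n
countTrue-bound {suc n} f = +-mono-≤ (𝟙≤1 (f fz)) (countTrue-bound (f ∘ fs))

countTrue-none : ∀ {n} {f : Fin n → Bool} → (∀ i → ¬ f i ≡ true) → countTrue f ≡ 0
countTrue-none {zero} p = refl
countTrue-none {suc n} {f} p rewrite ¬-not (p fz) = countTrue-none (p ∘ fs)

countTrue-unique : ∀ {n} {f : Fin n → Bool} → (∀ i j → f i ≡ true → f j ≡ true → i ≡ j) → countTrue f ≤ 1
countTrue-unique {zero} p = z≤n
countTrue-unique {suc n} {f} p with f fz in eq
... | true = s≤s (≤-reflexive (countTrue-none λ i fi → Fin.0≢1+n (p fz (fs i) eq fi)))
... | false = countTrue-unique λ i j fi fj → Fin.suc-injective (p (fs i) (fs j) fi fj)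

countTrue-cover : ∀ {n} {A : Set} (g : A → Fin n → Bool) β xs → All (λ a → countTrue (g a) ≤ β) xs →
  (f : Fin n → Bool) → (∀ i → f i ≡ true → Any (λ a → g a i ≡ true) xs) → countTrue f ≤ length xs * β
countTrue-cover g β [] [] f p = ≤-reflexive (countTrue-none λ i fi → case (p i fi))
  where
  case : ∀ {i} → ¬ Any (λ a → g a i ≡ true) []
  case ()
countTrue-cover g β (a ∷ xs) (q ∷ qs) f p =
  ≤-trans (countTrue-or split) (+-mono-≤ q (countTrue-cover g β xs qs (λ i → f i ∧ not (g a i)) rest))
  where
  split : ∀ i → f i ≡ true → g a i ≡ true ⊎ f i ∧ not (g a i) ≡ true
  split i fi with g a i
  ... | true = inj₁ refl
  ... | false = inj₂ (cong (_∧ true) fi)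
  rest : ∀ i → f i ∧ not (g a i) ≡ true → Any (λ a → g a i ≡ true) xs
  rest i e with ∧-true {f i} e
  ... | fi , ng with p i fi
  ... | here ga = contradiction (trans (sym ng) (cong not ga)) λ ()
  ... | there q = q

trues : ∀ {n} → (Fin n → Bool) → List (Fin n)
trues {zero} f = []
trues {suc n} f = if f fz then fz ∷ map fs (trues (f ∘ fs)) else map fs (trues (f ∘ fs))

length-trues : ∀ {n} (f : Fin n → Bool) → length (trues f) ≡ countTrue f
length-trues {zero} f = refl
length-trues {suc n} f with f fz
... | true = cong suc (trans (length-map fs (trues (f ∘ fs))) (length-trues (f ∘ fs)))
... | false = trans (length-map fs (trues (f ∘ fs))) (length-trues (f ∘ fs))

∈-trues⁺ : ∀ {n} (f : Fin n → Bool) {i} → f i ≡ true → i ∈ trues f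
∈-trues⁺ f {fz} fi rewrite fi = here refl
∈-trues⁺ f {fs i} fi with f fz
... | true = there (∈-map⁺ fs (∈-trues⁺ (f ∘ fs) fi))
... | false = ∈-map⁺ fs (∈-trues⁺ (f ∘ fs) fi)

∈-trues⁻ : ∀ {n} (f : Fin n → Bool) {i} → i ∈ trues f → f i ≡ true
∈-trues⁻ {suc n} f i∈ with f fz in eq
∈-trues⁻ {suc n} f (here refl) | true = eq
∈-trues⁻ {suc n} f (there i∈) | true with ∈-map⁻ fs i∈
... | j , j∈ , refl = ∈-trues⁻ (f ∘ fs) j∈
∈-trues⁻ {suc n} f i∈ | false with ∈-map⁻ fs i∈
... | j , j∈ , refl = ∈-trues⁻ (f ∘ fs) j∈

-- Walks and the two sides of a tree edge

module _ {A : Set} {R : A → A → Set} where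

  snoc : ∀ {x y z} → Walk R x y → R y z → Walk R x z
  snoc here r = step r here
  snoc (step s w) r = step s (snoc w r)

  _++ʷ_ : ∀ {x y z} → Walk R x y → Walk R y z → Walk R x z
  here ++ʷ w = w
  step r v ++ʷ w = step r (v ++ʷ w)

  reverse : (∀ {x y} → R x y → R y x) → ∀ {x y} → Walk R x y → Walk R y x
  reverse s here = here
  reverse s (step r w) = snoc (reverse s w) (s r)

mapʷ : ∀ {A : Set} {R S : A → A → Set} → (∀ {x y} → R x y → S x y) → ∀ {x y} → Walk R x y → Walk S x y
mapʷ f here = here
mapʷ f (step r w) = step (f r) (mapʷ f w)

module Tree {V : Set} {G : Graph V} (T : TreeDecomp G) where

  Node = Fin (m T)

  Edge : Node → Node → Set
  Edge x y = tadj T x y ≡ true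

  edge-sym : ∀ {x y} → Edge x y → Edge y x
  edge-sym {x} {y} e = trans (tsym T y x) e

  -- Spelled as in `SideA`, so that walks from `x` to leaves in this relation are literally proofs
  -- of `SideA T x y`.
  Avoid : Node → Node → Node → Node → Set
  Avoid x y u w = (tadj T u w ≡ true) × ¬ (u ≡ x × w ≡ y) × ¬ (u ≡ y × w ≡ x)

  avoid-sym : ∀ {x y u w} → Avoid x y u w → Avoid x y w u
  avoid-sym (e , p , q) = edge-sym e , (λ (a , b) → q (b , a)) , (λ (a , b) → p (b , a))

  avoid-flip : ∀ {x y u w} → Avoid x y u w → Avoid y x u w
  avoid-flip (e , p , q) = e , q , p

  -- Follow a walk from `x` to `z` in the whole tree; each passage over the edge `xy` restarts the
  -- recorded walk at the endpoint just reached.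
  side : ∀ x y z → Walk (Avoid x y) x z ⊎ Walk (Avoid x y) y z
  side x y z = go (inj₁ here) (connected T x z)
    where
    go : ∀ {u} → Walk (Avoid x y) x u ⊎ Walk (Avoid x y) y u → Walk Edge u z →
      Walk (Avoid x y) x z ⊎ Walk (Avoid x y) y z
    go s here = s
    go {u} s (step {y = w} e ws) with (u Fin.≟ x) ×-dec (w Fin.≟ y) | (u Fin.≟ y) ×-dec (w Fin.≟ x)
    ... | yes (refl , refl) | _ = go (inj₂ here) ws
    ... | no _ | yes (refl , refl) = go (inj₁ here) ws
    ... | no p | no q = go (extend s) ws
      where
      extend : Walk (Avoid x y) x u ⊎ Walk (Avoid x y) y u → Walk (Avoid x y) x w ⊎ Walk (Avoid x y) y w
      extend (inj₁ v) = inj₁ (snoc v (e , p , q))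
      extend (inj₂ v) = inj₂ (snoc v (e , p , q))

  -- The choice made by `side` is forced once `xy` is an edge, because a bridge leaves no walk
  -- joining its endpoints.
  near : Node → Node → Node → Bool
  near x y z with side x y z
  ... | inj₁ _ = true
  ... | inj₂ _ = false

  near-true : ∀ x y z → near x y z ≡ true → Walk (Avoid x y) x z
  near-true x y z p with side x y z
  ... | inj₁ w = w

  near-false : ∀ x y z → near x y z ≡ false → Walk (Avoid x y) y z
  near-false x y z p with side x y z
  ... | inj₂ w = w

  exclusive : ∀ {x y z} → Edge x y → Walk (Avoid x y) x z → Walk (Avoid x y) y z → ⊥
  exclusive e v w = bridges T _ _ e (v ++ʷ reverse avoid-sym w)

  true-near : ∀ {x y z} → Edge x y → Walk (Avoid x y) x z → near x y z ≡ true
  true-near {x} {y} {z} e v with side x y z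
  ... | inj₁ _ = refl
  ... | inj₂ w = ⊥-elim (exclusive e v w)

  false-near : ∀ {x y z} → Edge x y → Walk (Avoid x y) y z → near x y z ≡ false
  false-near {x} {y} {z} e w with side x y z
  ... | inj₁ v = ⊥-elim (exclusive e v w)
  ... | inj₂ _ = refl

  -- Cut a walk from `a` to `z` at its last visit to `a`: the next node is `b`, and the remainder
  -- avoids `a`.
  branch : ∀ a z → z ≡ a ⊎ ∃ λ b → Edge a b × Walk (Avoid b a) b z
  branch a z = go (inj₁ refl) (connected T a z)
    where
    go : ∀ {u} → u ≡ a ⊎ (∃ λ b → Edge a b × Walk (Avoid b a) b u) → Walk Edge u z →
      z ≡ a ⊎ ∃ λ b → Edge a b × Walk (Avoid b a) b z
    go s here = s
    go {u} s (step {y = w} e ws) with w Fin.≟ a | u Fin.≟ a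
    ... | yes p | _ = go (inj₁ p) ws
    ... | no p | yes refl = go (inj₂ (w , e , here)) ws
    go (inj₁ u≡a) (step e ws) | no p | no q = contradiction u≡a q
    go (inj₂ (b , ab , v)) (step e ws) | no p | no q =
      go (inj₂ (b , ab , snoc v (e , (λ (_ , r) → p r) , (λ (r , _) → q r)))) ws

  edge-irrefl : ∀ {x y} → Edge x y → x ≢ y
  edge-irrefl {x} e refl = contradiction (trans (sym e) (tirr T x)) λ ()

  -- A walk from `b` that avoids the bridge `ab` never meets `a`, so it cannot use the edge `ac`;
  -- the initial step from `a` to `b` differs from `ac` as `c ≢ b`.
  nested : ∀ {a b c z} → Edge a b → c ≢ b → Walk (Avoid b a) b z → Walk (Avoid a c) a z
  nested {a} {b} {c} {z} ab c≢b w =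
    step (ab , (λ (_ , b≡c) → c≢b (sym b≡c)) , (λ (_ , b≡a) → edge-irrefl ab (sym b≡a))) (go here w)
    where
    go : ∀ {u} → Walk (Avoid b a) b u → Walk (Avoid b a) u z → Walk (Avoid a c) u z
    go v here = here
    go v (step s@(e , _) ws) =
      step (e , (λ { (refl , _) → bridges T b a (edge-sym ab) v })
              , (λ { (_ , refl) → bridges T b a (edge-sym ab) (snoc v s) }))
           (go (snoc v s) ws)

  module _ {h : ℕ} (e : Fin h → V) (e-injective : ∀ i j → e i ≡ e j → i ≡ j)
    (β : ℕ) (β-small : 1 + 3 * β < h) where

    weight : Node → Node → ℕ
    weight x y = countTrue λ j → near x y (leaf T (e j))

    degree≤3 : ∀ a → countTrue (tadj T a) ≤ 3
    degree≤3 a with cubic T a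
    ... | inj₁ p = ≤-trans (≤-reflexive p) (s≤s z≤n)
    ... | inj₂ p = ≤-reflexive p

    -- The `h` marked leaves are spread over `a` itself, which is at most one of them, and at most
    -- three branches. If all branches were light, there would be at most `1 + 3 * β` marked leaves.
    heavy-branch : ∀ a → ∃ λ b → Edge a b × β < weight b a
    heavy-branch a with All.all? (λ b → weight b a ≤? β) (trues (tadj T a))
    ... | no p = let b , b∈ , q = find (All.¬All⇒Any¬ (λ b → weight b a ≤? β) _ p) in b , ∈-trues⁻ (tadj T a) b∈ , ≰⇒> q
    ... | yes p = contradiction β-small (≤⇒≯ (begin
      h ≡⟨ countTrue-all {h} {λ _ → true} (λ _ → refl) ⟨
      countTrue {h} (λ _ → true) ≤⟨ countTrue-or (λ j _ → here? j) ⟩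
      countTrue atₐ + countTrue (λ j → not (atₐ j)) ≤⟨ +-mono-≤ (countTrue-unique unique) (countTrue-cover _ β _ p _ covered) ⟩
      1 + length (trues (tadj T a)) * β ≤⟨ +-monoʳ-≤ 1 (*-monoˡ-≤ β (≤-trans (≤-reflexive (length-trues (tadj T a))) (degree≤3 a))) ⟩
      1 + 3 * β ∎))
      where
      open ≤-Reasoning
      atₐ : Fin h → Bool
      atₐ j = does (leaf T (e j) Fin.≟ a)
      at-true : ∀ j → atₐ j ≡ true → leaf T (e j) ≡ a
      at-true j q with leaf T (e j) Fin.≟ a
      ... | yes r = r
      here? : ∀ j → atₐ j ≡ true ⊎ not (atₐ j) ≡ true
      here? j with atₐ j
      ... | true = inj₁ refl
      ... | false = inj₂ refl
      unique : ∀ i j → atₐ i ≡ true → atₐ j ≡ true → i ≡ j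
      unique i j p q = e-injective i j (leaf-inj T _ _ (trans (at-true i p) (sym (at-true j q))))
      covered : ∀ j → not (atₐ j) ≡ true → Any (λ b → near b a (leaf T (e j)) ≡ true) (trues (tadj T a))
      covered j q with leaf T (e j) Fin.≟ a | branch a (leaf T (e j))
      ... | no r | inj₁ s = contradiction s r
      ... | no r | inj₂ (b , ab , w) = Any.map (λ { refl → true-near (edge-sym ab) w }) (∈-trues⁺ (tadj T a) ab)

    module _ (Good : Node → Node → Set)
      (lopsided : ∀ x y → Edge x y → Good x y ⊎
        (weight x y ≤ β ⊎ countTrue (λ j → not (near x y (leaf T (e j)))) ≤ β)) where

      -- Follow heavy branches; the part left behind is light, so the walk never turns back
      -- and the number of nodes behind it increases.
      descend : ∀ t {a b} → Edge a b → weight b a ≤ β → m T < countTrue (near b a) + t → ∃ λ x → ∃ λ y → Edge x y × Good x y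

      continue : ∀ t a → (∀ c → Edge a c → β < weight c a → m T < countTrue (near a c) + t) → ∃ λ x → ∃ λ y → Edge x y × Good x y
      continue t a fuel with heavy-branch a
      ... | c , ac , heavy with lopsided c a (edge-sym ac)
      ... | inj₁ good = c , a , edge-sym ac , good
      ... | inj₂ (inj₁ light) = contradiction light (<⇒≱ heavy)
      ... | inj₂ (inj₂ light) = descend t (edge-sym ac) (≤-trans (countTrue-≤ other) light) (fuel c ac heavy)
        where
        other : ∀ j → near a c (leaf T (e j)) ≡ true → not (near c a (leaf T (e j))) ≡ true
        other j p = cong not (false-near (edge-sym ac) (mapʷ avoid-flip (near-true a c _ p)))

      descend zero {a} {b} ab light fuel = contradiction (countTrue-bound (near b a)) (<⇒≱ (subst (m T <_) (+-identityʳ _) fuel))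
      descend (suc t) {a} {b} ab light fuel = continue t a λ c ac heavy →
        ≤-trans fuel (≤-trans (≤-reflexive (+-suc _ t)) (+-monoˡ-≤ t (grow c ac heavy)))
        where
        grow : ∀ c → Edge a c → β < weight c a → countTrue (near b a) < countTrue (near a c)
        grow c ac heavy = countTrue-< (λ z p → true-near ac (nested ab (λ { refl → <⇒≱ heavy light }) (near-true b a z p)))
          {a} (false-near (edge-sym ab) here) (true-near ac here)

      balanced-edge : ∃ λ x → ∃ λ y → Edge x y × Good x y
      -- Fuel `suc (m T)` is enough from any start, since at most `m T` nodes ever lie behind the
      -- walk.
      balanced-edge = continue (suc (m T)) (fromℕ< (≤-trans (s≤s z≤n) (two T))) λ _ _ _ → m≤n+m _ _

-- The triples

≡ᵇ-true : ∀ {m n} → m ≡ n → (m ≡ᵇ n) ≡ true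
≡ᵇ-true {m} {n} p = Equivalence.to T-≡ (≡⇒≡ᵇ m n p)

≡ᵇ-false : ∀ {m n} → m ≢ n → (m ≡ᵇ n) ≡ false
≡ᵇ-false {m} {n} p with m ≡ᵇ n in eq
... | false = refl
... | true = contradiction (≡ᵇ⇒≡ m n (Equivalence.from T-≡ eq)) p

if-true : ∀ {b} {x y : Bool} → b ≡ true → (if b then x else y) ≡ x
if-true refl = refl

if-false : ∀ {b} {x y : Bool} → b ≡ false → (if b then x else y) ≡ y
if-false refl = refl

-- The index counted from the beginning (false) or from the end (true) of a k-set.
P : ℕ → Bool → ℕ → ℕ
P k false i = i
P k true i = suc k ∸ i

mirror : ∀ {k i} → i ≤ suc k → (suc k ∸ i) + i ≡ suc k
mirror = m∸n+n≡m

P-injective : ∀ {k} σ {i j} → i ≤ suc k → j ≤ suc k → P k σ i ≡ P k σ j → i ≡ j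
P-injective false p q e = e
P-injective true p q e = ∸-cancelˡ-≡ p q e

double-≤-slack : ∀ {e i j} → i ≤ j → 2 * i ≤ e + 2 * j
double-≤-slack {e} p = ≤-trans (*-monoʳ-≤ 2 p) (m≤n+m _ e)

slack-<-double : ∀ {e i j} → e ≤ 1 → j < i → e + 2 * j < 2 * i
slack-<-double {e} {i} {j} e≤1 p = ≤-trans (s≤s (+-monoˡ-≤ _ e≤1)) (≤-trans (≤-reflexive (sym (*-suc 2 j))) (*-monoʳ-≤ 2 p))

-- A crossing has its threshold at index sum `k + 1`, so it pairs an index from one end with the
-- same index counted from the other end; matchings and antimatchings preserve the order. This is
-- why `σ` flips exactly at crossings.
regular-triangular : ∀ {κ} k σ → IsRegular κ →
  Triangular (λ i j → rel κ k (P k σ (suc i)) (P k (σ xor isCross κ) (suc j))) k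
regular-triangular k σ rm = subst (λ τ → Triangular (λ i j → rel regMatch k (P k σ (suc i)) (P k τ (suc j))) k) (sym (xor-identityʳ σ))
  (triangular false (λ i _ → ≡ᵇ-true {P k σ (suc i)} refl)
    (inj₁ λ i j i<j j<k → ≡ᵇ-false λ e → <⇒≢ i<j (suc-injective (P-injective {k} σ (s≤s (<⇒≤ (<-trans i<j j<k))) (s≤s (<⇒≤ j<k)) e))))
regular-triangular k σ ra with regular-triangular k σ rm
... | triangular b d (inj₁ o) = triangular (not b) (λ i p → cong not (d i p)) (inj₁ λ i j p q → cong not (o i j p q))
... | triangular b d (inj₂ o) = triangular (not b) (λ i p → cong not (d i p)) (inj₂ λ i j p q → cong not (o i j p q))
regular-triangular k false rc = triangular false
  (λ i i<k → ≤ᵇ-true (≤-reflexive (trans (+-comm k 1) (sym (trans (+-comm (suc i) _) (mirror (s≤s (<⇒≤ i<k))))))))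
  (inj₁ λ i j i<j j<k → ≤ᵇ-false (≤-trans (+-monoˡ-< (suc k ∸ suc j) (s≤s i<j))
    (≤-reflexive (trans (+-comm (suc j) _) (trans (mirror (s≤s (<⇒≤ j<k))) (+-comm 1 k))))))
regular-triangular k true rc = triangular false
  (λ i i<k → ≤ᵇ-true (≤-reflexive (trans (+-comm k 1) (sym (mirror (s≤s (<⇒≤ i<k)))))))
  (inj₂ λ i j i<j j<k → ≤ᵇ-false (≤-trans (+-monoʳ-< (suc k ∸ suc j) (s≤s i<j))
    (≤-reflexive (trans (mirror (s≤s (<⇒≤ j<k))) (+-comm 1 k)))))

-- A half graph is also triangular, with the roles of 0 and 1 exchanged, along the pairs next to its diagonal.
shifted-triangular : ∀ {x k} → x < k → Triangular (λ i j → rel regCross k (suc i) (k ∸ suc j)) x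
shifted-triangular {x} {suc k} (s≤s x≤k) = triangular true
  (λ i i<x → ≤ᵇ-false (s≤s (≤-reflexive (trans (cong suc (m+[n∸m]≡n (<⇒≤ (<-≤-trans i<x x≤k)))) (+-comm 1 k)))))
  (inj₂ λ i j i<j j<x → ≤ᵇ-true (s≤s (≤-trans
    (≤-reflexive (trans (+-comm k 1) (cong suc (sym (m+[n∸m]≡n (<⇒≤ (<-trans i<j (<-≤-trans j<x x≤k))))))))
    (+-monoˡ-≤ (k ∸ i) i<j))))

expPair-true : ∀ {e} → e ≤ 1 → ∀ i → expPair i (e + 2 * i) ≡ true
expPair-true z≤n i = cong (_∨ (2 * i ≡ᵇ 2 * i + 1)) (≡ᵇ-true {2 * i} refl)
expPair-true (s≤s z≤n) i = trans (cong ((1 + 2 * i ≡ᵇ 2 * i) ∨_) (≡ᵇ-true (+-comm 1 (2 * i)))) (∨-zeroʳ _)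

expPair-false : ∀ {e} → e ≤ 1 → ∀ {i j} → i ≢ j → expPair i (e + 2 * j) ≡ false
expPair-false z≤n {i} {j} i≢j = cong₂ _∨_
  (≡ᵇ-false λ p → i≢j (sym (*-cancelˡ-≡ j i 2 p)))
  (≡ᵇ-false λ p → even≢odd j i (trans p (+-comm (2 * i) 1)))
expPair-false (s≤s z≤n) {i} {j} i≢j = cong₂ _∨_
  (≡ᵇ-false λ p → even≢odd i j (sym p))
  (≡ᵇ-false λ p → i≢j (sym (*-cancelˡ-≡ j i 2 (suc-injective (trans p (+-comm (2 * i) 1))))))

-- In an expanding crossing the source index `k + 1 - I` is adjacent to `J'` iff `J' ≥ 2 * I`. Hence
-- `2 * I` and `2 * I + 1` are again the children of `I`, with the source counted from the end.
expanding-triangular : ∀ {κ} k x {e} → e ≤ 1 → x ≤ k → IsExpanding κ →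
  Triangular (λ i j → rel κ k (P k (isCross κ) (suc i)) (e + 2 * suc j)) x
expanding-triangular k x e≤1 x≤k em = triangular false (λ i _ → expPair-true e≤1 (suc i))
  (inj₁ λ i j i<j _ → expPair-false e≤1 (<⇒≢ (s≤s i<j)))
expanding-triangular k x e≤1 x≤k ea = triangular true (λ i _ → cong not (expPair-true e≤1 (suc i)))
  (inj₁ λ i j i<j _ → cong not (expPair-false e≤1 (<⇒≢ (s≤s i<j))))
expanding-triangular k x {e} e≤1 x≤k ec = triangular false
  (λ i i<x → ≤ᵇ-true (≤-trans (≤-reflexive (sum i i<x)) (+-monoʳ-≤ (2 * u i) (double-≤-slack {e} {suc i} ≤-refl))))
  (inj₂ λ i j i<j j<x → ≤ᵇ-false (≤-trans (+-monoʳ-< (2 * u j) (slack-<-double e≤1 (s≤s i<j))) (≤-reflexive (sym (sum j j<x)))))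
  where
  u : ℕ → ℕ
  u i = suc k ∸ suc i
  sum : ∀ i → i < x → 2 * k + 2 ≡ 2 * u i + 2 * suc i
  sum i i<x = trans (trans (+-comm (2 * k) 2) (sym (*-suc 2 k)))
    (trans (cong (2 *_) (sym (mirror (s≤s (<⇒≤ (<-≤-trans i<x x≤k)))))) (*-distribˡ-+ 2 (u i) (suc i)))

∸-cross : ∀ a b c d → a + d ≡ c + b → a ∸ b ≡ c ∸ d
∸-cross a b c d p = begin
  a ∸ b             ≡⟨ [m+n]∸[m+o]≡n∸o d a b ⟨
  (d + a) ∸ (d + b) ≡⟨ cong₂ _∸_ (trans (+-comm d a) (trans p (+-comm c b))) (+-comm d b) ⟩
  (b + c) ∸ (b + d) ≡⟨ [m+n]∸[m+o]≡n∸o b c d ⟩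
  c ∸ d             ∎
  where open ≡-Reasoning

-- Skew expanding triples

module Skew (p : ℕ) where

  k = 2 + 4 * p

  quarter : (k ∸ 2) / 4 ≡ p
  quarter = trans (cong (_/ 4) (*-comm 4 p)) (m*n/n≡m p 4)

  half : k / 2 ≡ 1 + 2 * p
  half = trans (cong (_/ 2) (solve 1 (λ p → con 2 :+ con 4 :* p := (con 1 :+ con 2 :* p) :* con 2) refl p)) (m*n/n≡m (1 + 2 * p) 2)
    where open +-*-Solver

  three-quarters : (3 * k + 2) / 4 ≡ 2 + 3 * p
  three-quarters = trans (cong (_/ 4) (solve 1 (λ p → con 3 :* (con 2 :+ con 4 :* p) :+ con 2 := (con 2 :+ con 3 :* p) :* con 4) refl p))
    (m*n/n≡m (2 + 3 * p) 4)
    where open +-*-Solver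

  p≤k : p ≤ k
  p≤k = ≤-trans (m≤n*m p 4) (m≤n+m _ 2)

  u : ℕ → ℕ
  u i = suc k ∸ suc i

  u+ : ∀ {i} → i < p → u i + suc i ≡ suc k
  u+ i<p = mirror (s≤s (<⇒≤ (<-≤-trans i<p p≤k)))

  low : ∀ {i} → i < p → (suc i ≤ᵇ (k ∸ 2) / 4) ≡ true
  low {i} i<p = ≤ᵇ-true (subst (suc i ≤_) (sym quarter) i<p)

  high : ∀ {i} → i < p → 2 + 3 * p < u i
  high {i} i<p = +-cancelʳ-≤ (suc i) _ _ (begin
    3 + 3 * p + suc i ≤⟨ +-monoʳ-≤ (3 + 3 * p) i<p ⟩
    3 + 3 * p + p     ≡⟨ solve 1 (λ p → con 3 :+ con 3 :* p :+ p := con 3 :+ con 4 :* p) refl p ⟩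
    suc k             ≡⟨ u+ i<p ⟨
    u i + suc i       ∎)
    where
    open ≤-Reasoning
    open +-*-Solver

  high₁ : ∀ {i} → i < p → (u i ≤ᵇ (k ∸ 2) / 4) ≡ false
  high₁ {i} i<p = ≤ᵇ-false (subst (_< u i) (sym quarter) (≤-<-trans (≤-trans (m≤n*m p 3) (m≤n+m _ 2)) (high i<p)))

  high₂ : ∀ {i} → i < p → (u i ≤ᵇ k / 2) ≡ false
  high₂ {i} i<p = ≤ᵇ-false (subst (_< u i) (sym half) (≤-<-trans (+-mono-≤ (s≤s (z≤n {1})) (*-monoˡ-≤ p (n≤1+n 2))) (high i<p)))

  high₃ : ∀ {i} → i < p → (u i ≤ᵇ (3 * k + 2) / 4) ≡ false
  high₃ {i} i<p = ≤ᵇ-false (subst (_< u i) (sym three-quarters) (high i<p))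

  2u+ : ∀ {i} → i < p → 2 * u i + 2 * suc i ≡ 2 * suc k
  2u+ {i} i<p = trans (sym (*-distribˡ-+ 2 (u i) (suc i))) (cong (2 *_) (u+ i<p))

  child≤k : ∀ {e j} → e ≤ 1 → j < p → e + 2 * suc j ≤ suc k
  child≤k e≤1 j<p = ≤-trans (+-mono-≤ e≤1 (*-monoʳ-≤ 2 j<p)) (≤-trans (+-monoʳ-≤ 1 (*-monoˡ-≤ p (m≤m+n 2 2))) (m≤n+m _ 2))

  upperPair : ℕ → ℕ → Bool
  upperPair J J' = (J' ≡ᵇ 2 * J ∸ k ∸ 2) ∨ (J' ≡ᵇ 2 * J ∸ k ∸ 1)

  -- For `J = k + 1 - I` the indices `2 * J - k - 2` and `2 * J - k - 1` are `1 + 2 * I` and `2 * I`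
  -- counted from the end: the last range is the doubling map read backwards.
  upperPair-mirror : ∀ {i} → i < p → ∀ J' → upperPair (u i) J' ≡ (J' ≡ᵇ suc k ∸ (1 + 2 * suc i)) ∨ (J' ≡ᵇ suc k ∸ 2 * suc i)
  upperPair-mirror {i} i<p J' = cong₂ (λ a b → (J' ≡ᵇ a) ∨ (J' ≡ᵇ b))
    (trans (∸-+-assoc (2 * u i) k 2) (∸-cross (2 * u i) (k + 2) (suc k) (1 + 2 * suc i) (trans (+-suc (2 * u i) _) (trans (cong suc (2u+ i<p))
      (solve 1 (λ k → con 1 :+ con 2 :* (con 1 :+ k) := con 1 :+ k :+ (k :+ con 2)) refl k)))))
    (trans (∸-+-assoc (2 * u i) k 1) (∸-cross (2 * u i) (k + 1) (suc k) (2 * suc i) (trans (2u+ i<p)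
      (solve 1 (λ k → con 2 :* (con 1 :+ k) := con 1 :+ k :+ (k :+ con 1)) refl k))))
    where open +-*-Solver

  upperPair-true : ∀ {e i} → e ≤ 1 → i < p → upperPair (u i) (suc k ∸ (e + 2 * suc i)) ≡ true
  upperPair-true {i = i} z≤n i<p = trans (upperPair-mirror i<p v)
    (trans (cong ((v ≡ᵇ suc k ∸ (1 + 2 * suc i)) ∨_) (≡ᵇ-true {v} refl)) (∨-zeroʳ (v ≡ᵇ suc k ∸ (1 + 2 * suc i))))
    where v = suc k ∸ 2 * suc i
  upperPair-true {i = i} (s≤s z≤n) i<p = trans (upperPair-mirror i<p v) (cong (_∨ (v ≡ᵇ suc k ∸ 2 * suc i)) (≡ᵇ-true {v} refl))
    where v = suc k ∸ (1 + 2 * suc i)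

  upperPair-false : ∀ {e i j} → e ≤ 1 → i < j → j < p → upperPair (u i) (suc k ∸ (e + 2 * suc j)) ≡ false
  upperPair-false {e} {i} {j} e≤1 i<j j<p = trans (upperPair-mirror (<-trans i<j j<p) (suc k ∸ (e + 2 * suc j))) (cong₂ _∨_
    (≡ᵇ-false λ q → <⇒≢ (1+2i< e) (sym (P-injective {k} true (child≤k e≤1 j<p) (child≤k ≤-refl (<-trans i<j j<p)) q)))
    (≡ᵇ-false λ q → <⇒≢ (≤-trans (n≤1+n _) (1+2i< e)) (sym (P-injective {k} true (child≤k e≤1 j<p) (child≤k {0} z≤n (<-trans i<j j<p)) q))))
    where
    1+2i< : ∀ e → 1 + 2 * suc i < e + 2 * suc j
    1+2i< e = ≤-trans (slack-<-double ≤-refl (s≤s i<j)) (m≤n+m _ e)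

  -- `σ` selects the first or the last `p` source indices. Matchings and antimatchings send them to
  -- children counted from the same end, crossings to children counted from the opposite end; the
  -- crossing thresholds become `2 * I + 1 ≥ e + 2 * J` for the first indices and
  -- `2 * I ≤ e + 2 * J` for the last.
  skew-triangular : ∀ {κ} σ {e} → e ≤ 1 → IsSkew κ →
    Triangular (λ i j → rel κ k (P k σ (suc i)) (P k (σ xor isCross κ) (e + 2 * suc j))) p
  skew-triangular false e≤1 sm = triangular false (λ i i<p → trans (if-true (low i<p)) (expPair-true e≤1 (suc i)))
    (inj₁ λ i j i<j j<p → trans (if-true (low (<-trans i<j j<p))) (expPair-false e≤1 (<⇒≢ (s≤s i<j))))
  skew-triangular false e≤1 sa = triangular false (λ i i<p → trans (if-true (low i<p)) (expPair-true e≤1 (suc i)))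
    (inj₁ λ i j i<j j<p → trans (if-true (low (<-trans i<j j<p))) (expPair-false e≤1 (<⇒≢ (s≤s i<j))))
  skew-triangular true e≤1 sm = triangular false
    (λ i i<p → trans (if-false (high₁ i<p)) (trans (if-false (high₃ i<p)) (upperPair-true e≤1 i<p)))
    (inj₁ λ i j i<j j<p → let i<p = <-trans i<j j<p in
      trans (if-false (high₁ i<p)) (trans (if-false (high₃ i<p)) (upperPair-false e≤1 i<j j<p)))
  skew-triangular true e≤1 sa = triangular false
    (λ i i<p → trans (if-false (high₁ i<p)) (trans (if-false (high₃ i<p)) (upperPair-true e≤1 i<p)))
    (inj₁ λ i j i<j j<p → let i<p = <-trans i<j j<p in
      trans (if-false (high₁ i<p)) (trans (if-false (high₃ i<p)) (upperPair-false e≤1 i<j j<p)))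
  skew-triangular false {e} e≤1 sc = triangular false
    (λ i i<p → trans (if-true (low i<p)) (≤ᵇ-true (s≤s⁻¹ (begin
      suc k                                              ≡⟨ w+ i<p ⟨
      w i + (e + 2 * suc i)                              ≤⟨ +-monoʳ-≤ (w i) (+-monoˡ-≤ (2 * suc i) e≤1) ⟩
      w i + (1 + 2 * suc i)                              ≡⟨ +-comm (w i) _ ⟩
      suc (2 * suc i + w i)                              ∎))))
    (inj₁ λ i j i<j j<p → trans (if-true (low (<-trans i<j j<p))) (≤ᵇ-false (s≤s⁻¹ (begin
      suc (suc (2 * suc i + w j))                        ≤⟨ +-monoˡ-≤ (w j) (slack-<-double {1} ≤-refl (s≤s i<j)) ⟩
      2 * suc j + w j                                    ≤⟨ +-monoˡ-≤ (w j) (m≤n+m (2 * suc j) e) ⟩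
      e + 2 * suc j + w j                                ≡⟨ +-comm _ (w j) ⟩
      w j + (e + 2 * suc j)                              ≡⟨ w+ j<p ⟩
      suc k                                              ∎))))
    where
    open ≤-Reasoning
    w : ℕ → ℕ
    w j = suc k ∸ (e + 2 * suc j)
    w+ : ∀ {j} → j < p → w j + (e + 2 * suc j) ≡ suc k
    w+ j<p = mirror (child≤k e≤1 j<p)
  skew-triangular true {e} e≤1 sc = triangular false
    (λ i i<p → trans (skip i<p) (≤ᵇ-true (m+n≤o⇒m≤o∸n (2 * k) (begin
      2 * k + 2                   ≡⟨ total i<p ⟩
      2 * u i + 2 * suc i         ≤⟨ +-monoʳ-≤ (2 * u i) (double-≤-slack {e} {suc i} ≤-refl) ⟩
      2 * u i + (e + 2 * suc i)   ∎))))
    (inj₂ λ i j i<j j<p → trans (skip j<p) (≤ᵇ-false (m<n+o⇒m∸n<o _ 2 (begin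
      suc (2 * u j + (e + 2 * suc i)) ≤⟨ +-monoʳ-< (2 * u j) (slack-<-double e≤1 (s≤s i<j)) ⟩
      2 * u j + 2 * suc j             ≡⟨ total j<p ⟨
      2 * k + 2                       ≡⟨ +-comm (2 * k) 2 ⟩
      2 + 2 * k                       ∎))))
    where
    open ≤-Reasoning
    total : ∀ {i} → i < p → 2 * k + 2 ≡ 2 * u i + 2 * suc i
    total i<p = trans (+-comm (2 * k) 2) (trans (sym (*-suc 2 k)) (sym (2u+ i<p)))
    skip : ∀ {i J'} → i < p → rel skewCross k (u i) J' ≡ ((2 * k) ≤ᵇ (2 * u i + J' ∸ 2))
    skip i<p = trans (if-false (high₁ i<p)) (trans (if-false (high₂ i<p)) (if-false (high₃ i<p)))

-- Carousels

toℕ-mod : ∀ {a n} .{{_ : NonZero n}} → a < n → toℕ (a mod n) ≡ a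
toℕ-mod {a} {n} a<n = trans (Fin.toℕ-fromℕ< (m%n<n a n)) (m<n⇒m%n≡m a<n)

odd? : ℕ → Bool
odd? zero = false
odd? (suc n) = not (odd? n)

odd?-% : ∀ n → odd? n ≡ (n % 2 ≡ᵇ 1)
odd?-% zero = refl
odd?-% (suc zero) = refl
odd?-% (suc (suc n)) = trans (not-involutive (odd? n)) (odd?-% n)

countTrue-cong : ∀ {n} {f g : Fin n → Bool} → (∀ i → f i ≡ g i) → countTrue f ≡ countTrue g
countTrue-cong {zero} p = refl
countTrue-cong {suc n} p = cong₂ (λ b c → 𝟙 b + c) (p fz) (countTrue-cong (p ∘ fs))

module Carousel (l k : ℕ) (2≤l : 2 ≤ l) .{{_ : NonZero k}} (G : Graph (Fin (suc l) × Fin k))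
  (kinds : Fin (suc l) → Kind) (carousel : CarouselWith (suc l) k G kinds) where

  n = suc l

  first-cross = proj₁ carousel
  middle-regular = proj₁ (proj₂ carousel)
  adjacency = proj₂ (proj₂ carousel)

  node : ℕ → Fin n
  node a = a mod n

  -- Indices J run over 1, …, k; other values of J are junk.
  vertex : ℕ → ℕ → Fin n × Fin k
  vertex a J = node a , pred J mod k

  InRange : ℕ → Set
  InRange J = 1 ≤ J × J ≤ k

  toℕ-vertex : ∀ {J} → InRange J → suc (toℕ (pred J mod k)) ≡ J
  toℕ-vertex {suc J} (_ , J<k) = cong suc (toℕ-mod J<k)

  kind : ℕ → Kind
  kind a = kinds (node a)

  -- Whether the order of X_a is reversed, after σ at X_0, when crossings are followed from X_0 to X_a.
  orient : Bool → ℕ → Bool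
  orient σ zero = σ
  orient σ (suc a) = orient σ a xor isCross (kind a)

  orient-odd? : ∀ σ a → orient σ a ≡ σ xor odd? (cnt (isCross ∘ kind) a)
  orient-odd? σ zero = sym (xor-identityʳ σ)
  orient-odd? σ (suc a) = trans (cong (_xor isCross (kind a)) (orient-odd? σ a))
    (trans (xor-assoc σ _ _) (cong (σ xor_) (add (isCross (kind a)) (cnt (isCross ∘ kind) a))))
    where
    add : ∀ b c → odd? c xor b ≡ odd? (𝟙 b + c)
    add true c = trans (xor-comm (odd? c) true) refl
    add false c = xor-identityʳ (odd? c)

  -- Each cross triple reverses the order once, so a full round depends only on the parity that
  -- separates even from odd carousels.
  orient-round : ∀ σ → orient σ n ≡ σ xor (countTrue (λ a → isCross (kinds a)) % 2 ≡ᵇ 1)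
  orient-round σ = trans (orient-odd? σ n) (cong (σ xor_) (trans (odd?-% (cnt (isCross ∘ kind) n)) (cong (λ c → c % 2 ≡ᵇ 1)
    (trans (sym (countTrue-cnt (isCross ∘ kind) n)) (countTrue-cong λ i → cong (isCross ∘ kinds) (Fin.toℕ-injective (toℕ-mod (Fin.toℕ<n i))))))))

  P-range : ∀ σ {i} → InRange i → InRange (P k σ i)
  P-range false p = p
  P-range true {suc i} (_ , i<k) = m<n⇒0<n∸m i<k , m∸n≤m k i

  adj-rel : ∀ a b {J J'} → Next (node a) (node b) → InRange J → InRange J' →
    adj G (vertex a J) (vertex b J') ≡ rel (kind a) k J J'
  adj-rel a b nx p q = trans (adjacency (node a) (node b) nx _ _) (cong₂ (rel (kind a) k) (toℕ-vertex p) (toℕ-vertex q))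

  adj-triangular : ∀ a b (p q : ℕ → ℕ) x → Next (node a) (node b) →
    (∀ i → i < x → InRange (p i)) → (∀ i → i < x → InRange (q i)) →
    Triangular (λ i j → rel (kind a) k (p i) (q j)) x → Triangular (λ i j → adj G (vertex a (p i)) (vertex b (q j))) x
  adj-triangular a b p q x nx P Q (triangular c d o) = triangular c (λ i u → trans (entry u u) (d i u)) (off o)
    where
    entry : ∀ {i j} → i < x → j < x → adj G (vertex a (p i)) (vertex b (q j)) ≡ rel (kind a) k (p i) (q j)
    entry {i} {j} u v = adj-rel a b nx (P i u) (Q j v)
    off : (∀ i j → i < j → j < x → rel (kind a) k (p i) (q j) ≡ c) ⊎ (∀ i j → i < j → j < x → rel (kind a) k (p j) (q i) ≡ c) →
      (∀ i j → i < j → j < x → adj G (vertex a (p i)) (vertex b (q j)) ≡ c) ⊎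
      (∀ i j → i < j → j < x → adj G (vertex a (p j)) (vertex b (q i)) ≡ c)
    off (inj₁ o) = inj₁ λ i j u v → trans (entry (<-trans u v) v) (o i j u v)
    off (inj₂ o) = inj₂ λ i j u v → trans (entry v (<-trans u v)) (o i j u v)

  next : ∀ {a} → suc a < n → Next (node a) (node (suc a))
  next {a} p = inj₁ (trans (cong (_+ 1) (toℕ-mod (<⇒≤ p))) (trans (+-comm a 1) (sym (toℕ-mod p))))

  last-next : Next (node l) (node 0)
  last-next = inj₂ (trans (cong (_+ 1) (toℕ-mod {l} ≤-refl)) (+-comm l 1) , refl)

  kind-regular : ∀ a → suc a < n → IsRegular (kind a)
  kind-regular zero p = subst IsRegular (sym (first-cross (node 0) refl)) rc
  kind-regular (suc a) p = middle-regular (node (suc a)) (subst (1 ≤_) (sym eq) (s≤s z≤n))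
    (≤-trans (≤-reflexive (trans (cong (_+ 2) eq) (+-comm (suc a) 2))) p)
    where eq = toℕ-mod (<⇒≤ p)

  -- Colour disagreements around the carousel

  module Coloured (r : ℕ) (Y Z : Fin n × Fin k → Set)
    (col : Fin n × Fin k → Bool) (inY : ∀ v → col v ≡ true → Y v) (inZ : ∀ v → col v ≡ false → Z v) where

    open CutRank G r Y Z col inY inZ

    Rank = RankAtLeast G Y Z r

    disagreements : (U W : ℕ → Fin n × Fin k) → ℕ → ℕ
    disagreements U W = cnt (λ i → col (U i) xor col (W i))

    disagreements-trans : ∀ U W W' {a b} x → disagreements U W x ≤ a ⊎ Rank → disagreements W W' x ≤ b ⊎ Rank →
      disagreements U W' x ≤ a + b ⊎ Rank
    disagreements-trans U W W' x (inj₂ rk) _ = inj₂ rk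
    disagreements-trans U W W' x (inj₁ _) (inj₂ rk) = inj₂ rk
    disagreements-trans U W W' x (inj₁ p) (inj₁ q) =
      inj₁ (≤-trans (cnt-or x λ i _ → xor-trans (col (U i)) (col (W i))) (+-mono-≤ p q))

    disagreements-shrink : ∀ U W {a x y} → x ≤ y → disagreements U W y ≤ a ⊎ Rank → disagreements U W x ≤ a ⊎ Rank
    disagreements-shrink U W x≤y (inj₁ p) = inj₁ (≤-trans (cnt-mono _ x≤y) p)
    disagreements-shrink U W x≤y (inj₂ rk) = inj₂ rk

    disagreements-sym : ∀ {a x} U W → disagreements U W x ≤ a ⊎ Rank → disagreements W U x ≤ a ⊎ Rank
    disagreements-sym {x = x} U W (inj₁ p) = inj₁ (≤-trans (cnt-≤ x λ i _ → xor-swap (col (W i)) (col (U i))) p)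
    disagreements-sym U W (inj₂ rk) = inj₂ rk

    link : ∀ a b (p q : ℕ → ℕ) x → Next (node a) (node b) →
      (∀ i → i < x → InRange (p i)) → (∀ i → i < x → InRange (q i)) → Triangular (λ i j → rel (kind a) k (p i) (q j)) x →
      disagreements (vertex a ∘ p) (vertex b ∘ q) x ≤ 2 * r ⊎ Rank
    link a b p q x nx P Q t = few-violations (vertex a ∘ p) (vertex b ∘ q) x (adj-triangular a b p q x nx P Q t)

    X : Bool → ℕ → ℕ → Fin n × Fin k
    X σ a i = vertex a (P k (orient σ a) (suc i))

    X-range : ∀ τ i → i < k → InRange (P k τ (suc i))
    X-range τ i i<k = P-range τ (s≤s z≤n , i<k)

    -- With orientations following the crossings, every regular triple pairs equal positions `i`,
    -- and each triple passed adds at most `2 * r` disagreements.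
    path : ∀ σ a → a < n → disagreements (X σ 0) (X σ a) k ≤ a * (2 * r) ⊎ Rank
    path σ zero p = inj₁ (≤-reflexive (cnt-empty k λ i _ → xor-irrefl {col (X σ 0 i)} refl))
    path σ (suc a) p with disagreements-trans (X σ 0) (X σ a) (X σ (suc a)) k (path σ a (<⇒≤ p))
      (link a (suc a) (λ i → P k (orient σ a) (suc i)) (λ i → P k (orient σ (suc a)) (suc i)) k (next p)
        (X-range (orient σ a)) (X-range (orient σ (suc a))) (regular-triangular k (orient σ a) (kind-regular a p)))
    ... | inj₂ rk = inj₂ rk
    ... | inj₁ q = inj₁ (≤-trans q (≤-reflexive (+-comm (a * (2 * r)) (2 * r))))

    -- The indices `i + 1` and `i + 2` share the partner `k - (i + 1)` in the next set. The index
    -- sums are `k` and `k + 1`, just below and at the threshold of the crossing, and both pairings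
    -- are triangular.
    neighbours : ∀ {x} → x < k → disagreements (vertex 0 ∘ suc) (vertex 0 ∘ suc ∘ suc) x ≤ 2 * r + 2 * r ⊎ Rank
    neighbours {x} x<k = disagreements-trans (vertex 0 ∘ suc) (λ i → vertex 1 (k ∸ suc i)) (vertex 0 ∘ suc ∘ suc) x
      (link 0 1 suc (λ i → k ∸ suc i) x (next 1<n) (λ i i<x → s≤s z≤n , <-trans i<x x<k)
        (λ i i<x → m<n⇒0<n∸m (<-≤-trans (s≤s i<x) x<k) , m∸n≤m k (suc i))
        (subst (λ κ → Triangular (λ i j → rel κ k (suc i) (k ∸ suc j)) x) (sym kind₀) (shifted-triangular x<k)))
      (disagreements-sym {x = x} (vertex 0 ∘ suc ∘ suc) (λ i → vertex 1 (k ∸ suc i))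
        (link 0 1 (suc ∘ suc) (λ i → k ∸ suc i) x (next 1<n) (λ i i<x → s≤s z≤n , <-≤-trans (s≤s i<x) x<k)
        (λ i i<x → m<n⇒0<n∸m (<-≤-trans (s≤s i<x) x<k) , m∸n≤m k (suc i))
        (subst (λ κ → Triangular (λ i j → rel κ k (suc (suc i)) (k ∸ suc j)) x) (sym kind₀)
          (tail (regular-triangular k false rc)))))
      where
      1<n : 1 < n
      1<n = s≤s (≤-trans (s≤s z≤n) 2≤l)
      kind₀ : kind 0 ≡ regCross
      kind₀ = first-cross (node 0) refl
      tail : ∀ {M} → Triangular M k → Triangular (λ i j → M (suc i) (suc j)) x
      tail (triangular b d (inj₁ o)) = triangular b (λ i p → d (suc i) (<-≤-trans (s≤s p) x<k))
        (inj₁ λ i j p q → o (suc i) (suc j) (s≤s p) (<-≤-trans (s≤s q) x<k))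
      tail (triangular b d (inj₂ o)) = triangular b (λ i p → d (suc i) (<-≤-trans (s≤s p) x<k))
        (inj₂ λ i j p q → o (suc i) (suc j) (s≤s p) (<-≤-trans (s≤s q) x<k))

  -- In an even carousel all expansion happens along one order of X_0, so sheet is constantly false;
  -- in an odd one the two ends of X_0 expand into each other and sheet is the identity.
  module _ (r : ℕ) (sheet : Bool → Bool) (sheet-false : sheet false ≡ false) (p : ℕ)
    (p-large : suc p ≡ 2 ^ (8 + 3 * (1 + n * (2 * r)))) (h≤k : 1 + 2 * p ≤ k)
    (expansion : ∀ σ e → e ≤ 1 →
      Triangular (λ i j → rel (kind l) k (P k (orient (sheet σ) l) (suc i)) (P k (sheet (not σ)) (e + 2 * suc j))) p)
    where

    -- At most `2 * r` disagreements for each of the `n` triples, and one for the junk index 0. The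
    -- indices 1 to `h` below are all of X_0 in an even carousel and its first half in an odd one.
    N = 1 + n * (2 * r)
    h = 1 + 2 * p
    β = 2 ^ (6 + 3 * N)

    p≤k : p ≤ k
    p≤k = ≤-trans (m≤n*m p 2) (≤-trans (n≤1+n _) h≤k)

    p<k : p < k
    p<k = ≤-trans (s≤s (m≤n*m p 2)) h≤k

    -- `path` followed by the last triple compares parents with children, and `neighbours` compares
    -- consecutive indices; these are the inputs of `almost-constant`.
    sparse : ∀ Y Z (col : Fin n × Fin k → Bool) → (∀ v → col v ≡ true → Y v) → (∀ v → col v ≡ false → Z v) →
      (∃ λ γ → cnt (λ i → col (vertex 0 (suc i)) xor γ) h ≤ β) ⊎ RankAtLeast G Y Z r
    sparse Y Z col inY inZ with expand false 0 z≤n | expand true 0 z≤n | expand false 1 ≤-refl | expand true 1 ≤-refl | shift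
      where
      open Coloured r Y Z col inY inZ
      open CutRank G r Y Z col inY inZ
      d : Bool → ℕ → Fin n × Fin k
      d σ i = vertex 0 (P k (sheet σ) i)
      -- `almost-constant` counts from index 0, which is junk here and costs at most one
      -- disagreement.
      guard : ∀ {f a} → cnt (f ∘ suc) p ≤ a ⊎ Rank → cnt f (suc p) ≤ 1 + a ⊎ Rank
      guard {f} (inj₁ q) = inj₁ (≤-trans (cnt-suc-≤ f p) (s≤s q))
      guard (inj₂ rk) = inj₂ rk
      expand : ∀ σ e → e ≤ 1 → cnt (λ i → col (d σ i) xor col (d (not σ) (e + 2 * i))) (suc p) ≤ 1 + (l * (2 * r) + 2 * r) ⊎ Rank
      expand σ e e≤1 = guard (disagreements-trans (X (sheet σ) 0) (X (sheet σ) l) (λ i → d (not σ) (e + 2 * suc i)) p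
        (disagreements-shrink (X (sheet σ) 0) (X (sheet σ) l) p≤k (path (sheet σ) l ≤-refl))
        (link l 0 (λ i → P k (orient (sheet σ) l) (suc i)) (λ i → P k (sheet (not σ)) (e + 2 * suc i)) p last-next
          (λ i i<p → X-range (orient (sheet σ) l) i (<-≤-trans i<p p≤k))
          (λ i i<p → P-range (sheet (not σ)) (≤-trans (s≤s z≤n) (m≤n+m _ e) , ≤-trans (+-mono-≤ e≤1 (*-monoʳ-≤ 2 i<p)) h≤k))
          (expansion σ e e≤1)))
      shift : cnt (λ i → col (vertex 0 i) xor col (vertex 0 (suc i))) (suc p) ≤ 1 + (2 * r + 2 * r) ⊎ Rank
      shift = guard (neighbours p<k)
    ... | inj₂ rk | _ | _ | _ | _ = inj₂ rk
    ... | _ | inj₂ rk | _ | _ | _ = inj₂ rk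
    ... | _ | _ | inj₂ rk | _ | _ = inj₂ rk
    ... | _ | _ | _ | inj₂ rk | _ = inj₂ rk
    ... | _ | _ | _ | _ | inj₂ rk = inj₂ rk
    ... | inj₁ f0 | inj₁ t0 | inj₁ f1 | inj₁ t1 | inj₁ sh
      with almost-constant (λ σ i → col (vertex 0 (P k (sheet σ) i))) N
             (λ { false → bound f0 ; true → bound t0 }) (λ { false → bound f1 ; true → bound t1 })
             (subst (λ τ → cnt (λ i → col (vertex 0 (P k τ i)) xor col (vertex 0 (P k τ (suc i)))) (2 ^ (8 + 3 * N)) ≤ N) (sym sheet-false)
               (≤-trans (≤-reflexive (cong (cnt _) (sym p-large))) (≤-trans sh (s≤s shift≤))))
      where
      bound : ∀ {f} → cnt f (suc p) ≤ 1 + (l * (2 * r) + 2 * r) → cnt f (2 ^ (8 + 3 * N)) ≤ N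
      bound {f} q = ≤-trans (≤-reflexive (cong (cnt f) (sym p-large))) (≤-trans q (s≤s (≤-reflexive (+-comm (l * (2 * r)) (2 * r)))))
      shift≤ : 2 * r + 2 * r ≤ n * (2 * r)
      shift≤ = +-monoʳ-≤ (2 * r) (m≤n*m (2 * r) l {{>-nonZero (≤-trans (s≤s z≤n) 2≤l)}})
    -- Index 0 is dropped again: the `2 * suc p` indices counted are 0 and 1 to `h`.
    ... | γ , q = inj₁ (γ , ≤-trans (cnt-suc-≥ (λ i → col (vertex 0 i) xor γ) h)
      (subst₂ (λ τ y → cnt (λ i → col (vertex 0 (P k τ i)) xor γ) y ≤ β) sheet-false
        (trans (cong (2 *_) (sym p-large)) (*-suc 2 p)) q))

    rankwidth : RankwidthAtLeast G r
    rankwidth = inj₂ ((vertex 0 1 , vertex 1 1 , λ e → 0≢1 (cong (toℕ ∘ proj₁) e)) , λ T → width T)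
      where
      0≢1 : ¬ toℕ (node 0) ≡ toℕ (node 1)
      0≢1 e with trans e (toℕ-mod (s≤s (≤-trans (s≤s z≤n) 2≤l)))
      ... | ()
      start : Fin h → Fin n × Fin k
      start j = vertex 0 (suc (toℕ j))
      start-injective : ∀ i j → start i ≡ start j → i ≡ j
      start-injective i j e = Fin.toℕ-injective (suc-injective (trans (sym (toℕ-vertex (in-range i)))
        (trans (cong (suc ∘ toℕ ∘ proj₂) e) (toℕ-vertex (in-range j)))))
        where
        in-range : ∀ (i : Fin h) → InRange (suc (toℕ i))
        in-range i = s≤s z≤n , ≤-trans (Fin.toℕ<n i) h≤k
      -- `suc h` is exactly `8 * β`, whereas `3 + 3 * β` is at most `6 * β`.
      β-small : 1 + 3 * β < h
      β-small = s≤s⁻¹ (begin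
        3 + 3 * β           ≤⟨ +-monoˡ-≤ (3 * β) (*-monoʳ-≤ 3 (m^n>0 2 (6 + 3 * N))) ⟩
        3 * β + 3 * β       ≤⟨ m≤n+m _ (2 * β) ⟩
        2 * β + (3 * β + 3 * β) ≡⟨ solve 1 (λ b → con 2 :* b :+ (con 3 :* b :+ con 3 :* b) := con 2 :* (con 2 :* (con 2 :* b))) refl β ⟩
        2 * 2 ^ (8 + 3 * N) ≡⟨ cong (2 *_) p-large ⟨
        2 * suc p           ≡⟨ *-suc 2 p ⟩
        suc h               ∎)
        where
        open ≤-Reasoning
        open +-*-Solver
      width : ∀ T → WidthAtLeast T r
      width T = balanced-edge start start-injective β β-small (λ x y → RankAtLeast G (SideA T x y) (SideB T x y) r) lopsided
        where
        open Tree T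
        lopsided : ∀ x y → Edge x y → RankAtLeast G (SideA T x y) (SideB T x y) r ⊎
          (countTrue (λ j → near x y (leaf T (start j))) ≤ β ⊎ countTrue (λ j → not (near x y (leaf T (start j)))) ≤ β)
        lopsided x y xy with sparse (SideA T x y) (SideB T x y) (λ v → near x y (leaf T v))
          (λ v → near-true x y (leaf T v)) (λ v q w → exclusive xy w (near-false x y (leaf T v) q))
        ... | inj₂ rk = inj₁ rk
        ... | inj₁ (false , q) = inj₂ (inj₁ (≤-trans (≤-reflexive (trans
              (countTrue-cong {h} λ j → sym (xor-identityʳ (c (suc (toℕ j))))) (countTrue-cnt (λ i → c (suc i) xor false) h))) q))
          where c = λ i → near x y (leaf T (vertex 0 i))
        ... | inj₁ (true , q) = inj₂ (inj₂ (≤-trans (≤-reflexive (trans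
              (countTrue-cong {h} λ j → xor-comm true (c (suc (toℕ j)))) (countTrue-cnt (λ i → c (suc i) xor true) h))) q))
          where c = λ i → near x y (leaf T (vertex 0 i))

-- Choice of the order, and the two kinds of carousel

module _ (l r : ℕ) (2≤l : 2 ≤ l) where

  -- One more than the exponent of `suc p`, so that `2 ^ order - 1` is `1 + 2 * p`.
  order : ℕ
  order = 9 + 3 * (1 + suc l * (2 * r))

  p : ℕ
  p = pred (2 ^ (8 + 3 * (1 + suc l * (2 * r))))

  p-large : suc p ≡ 2 ^ (8 + 3 * (1 + suc l * (2 * r)))
  p-large = suc-pred _ {{m^n≢0 2 (8 + 3 * (1 + suc l * (2 * r)))}}

  evenK-order : evenK order ≡ 1 + 2 * p
  evenK-order = trans (cong (λ q → 2 * q ∸ 1) (sym p-large)) (cong (_∸ 1) (*-suc 2 p))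

  oddK-order : oddK order ≡ 2 + 4 * p
  oddK-order = trans (cong (2 *_) evenK-order) (solve 1 (λ p → con 2 :* (con 1 :+ con 2 :* p) := con 2 :+ con 4 :* p) refl p)
    where open +-*-Solver

  -- The size is a variable with an equation so that matching on `refl` puts `1 + 2 * p` into the
  -- type of `G`.
  even-carousel : ∀ k → k ≡ 1 + 2 * p → (G : Graph (Fin (suc l) × Fin k)) → ∀ kinds → CarouselWith (suc l) k G kinds →
    (∀ a → toℕ a + 1 ≡ suc l → IsExpanding (kinds a)) → countTrue (λ a → isCross (kinds a)) % 2 ≡ 0 → RankwidthAtLeast G r
  even-carousel k refl G kinds carousel expanding parity =
    rankwidth r (λ _ → false) refl p p-large ≤-refl λ σ e e≤1 →
      subst (λ τ → Triangular (λ i j → rel (kind l) k (P k τ (suc i)) (e + 2 * suc j)) p) (sym closing)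
        (expanding-triangular k p e≤1 (≤-trans (m≤n*m p 2) (n≤1+n _))
          (expanding (node l) (trans (cong (_+ 1) (toℕ-mod {l} ≤-refl)) (+-comm l 1))))
    where
    open Carousel l k 2≤l G kinds carousel
    -- A full round restores the order, so before the last triple it is reversed exactly when that
    -- triple is a crossing, as `expanding-triangular` expects.
    closing : orient false l ≡ isCross (kind l)
    closing = xor-false (trans (orient-round false) (cong (_≡ᵇ 1) parity))

  odd-carousel : ∀ k → k ≡ 2 + 4 * p → (G : Graph (Fin (suc l) × Fin k)) → ∀ kinds → CarouselWith (suc l) k G kinds →
    (∀ a → toℕ a + 1 ≡ suc l → IsSkew (kinds a)) → countTrue (λ a → isCross (kinds a)) % 2 ≡ 1 → RankwidthAtLeast G r
  odd-carousel k refl G kinds carousel skew parity =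
    rankwidth r id refl p p-large (+-mono-≤ (n≤1+n 1) (*-monoˡ-≤ p (m≤m+n 2 2))) λ σ e e≤1 →
      subst (λ τ → Triangular (λ i j → rel (kind l) k (P k (orient σ l) (suc i)) (P k τ (e + 2 * suc j))) p) (closing σ)
        (Skew.skew-triangular p (orient σ l) e≤1 (skew (node l) (trans (cong (_+ 1) (toℕ-mod {l} ≤-refl)) (+-comm l 1))))
    where
    open Carousel l k 2≤l G kinds carousel
    -- A full round reverses the order, so each end of X_0 expands into the other.
    closing : ∀ σ → orient σ l xor isCross (kind l) ≡ not σ
    closing σ = trans (orient-round σ) (trans (cong (λ c → σ xor (c ≡ᵇ 1)) parity) (xor-comm σ true))

theorem5 : ∀ (n r : ℕ) → 3 ≤ n → 1 ≤ r →
    ∃ λ s → 1 ≤ s ×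
    (∀ (G : Graph (Fin n × Fin (evenK s))) → EvenCarousel n s G → RankwidthAtLeast G r) ×
    (∀ (G : Graph (Fin n × Fin (oddK s))) → OddCarousel n s G → RankwidthAtLeast G r)
theorem5 (suc l) r (s≤s 2≤l) _ = order l r 2≤l , s≤s z≤n ,
  (λ G (kinds , c , x , q) → even-carousel l r 2≤l _ (evenK-order l r 2≤l) G kinds c x q) ,
  (λ G (kinds , c , x , q) → odd-carousel l r 2≤l _ (oddK-order l r 2≤l) G kinds c x q)
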